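{- Let $\kappa$ be a Mahlo cardinal and let $\lambda,\lambda'$ be cardinals with $\kappa\le\lambda<\lambda'$. Suppose $S\subseteq\mathcal{P}_\kappa\lambda$. Then $S$ is $1$-stationary in $\mathcal{P}_\kappa\lambda$ if and only if $S\uparrow\lambda'$ is $1$-stationary in $\mathcal{P}_\kappa\lambda'$.
   Context: For a set $A$, $\mathcal{P}_\kappa A=\{x\subseteq A:|x|<\kappa\}$. A weakly inaccessible cardinal is an uncountable regular limit cardinal. A Mahlo cardinal is a strongly inaccessible cardinal in which the set of smaller inaccessible cardinals is stationary. For a weakly inaccessible $\kappa$ and $A\supseteq\kappa$: a set $S\subseteq\mathcal{P}_\kappa A$ is unbounded ($0$-stationary) in $\mathcal{P}_\kappa A$ if for every $x\in\mathcal{P}_\kappa A$ there is $y\in S$ with $x\subseteq y$. $S\subseteq\mathcal{P}_\kappa A$ is $1$-stationary in $\mathcal{P}_\kappa A$ if for every unbounded $T\subseteq\mathcal{P}_\kappa A$ there is $x\in S$ such that $\mu:=x\cap\kappa$ is a weakly inaccessible cardinal and $T\cap\mathcal{P}_\mu x$ is unbounded in $\mathcal{P}_\mu x$. For $\kappa\subseteq A\subseteq B$ and $S\subseteq\mathcal{P}_\kappa A$, $S\uparrow B:=\{y\in\mathcal{P}_\kappa B: y\cap A\in S\}$; here $S\uparrow\lambda'$ is taken with $A=\lambda$, $B=\lambda'$. -}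

module Defs where

open import Level using (0ℓ; suc)
open import Axiom.ExcludedMiddle using (ExcludedMiddle)
open import Data.Bool using (Bool; true; false)
open import Data.Nat using (ℕ)
open import Data.Product using (Σ; Σ-syntax; _×_; _,_; proj₁; proj₂)
open import Data.Sum using (_⊎_)
open import Function.Bundles using (Func; Injection; Bijection)
open import Relation.Binary.Bundles using (Setoid)
open import Relation.Binary.PropositionalEquality using (_≡_; refl; setoid)
open import Relation.Nullary using (¬_; yes; no; contradiction)

-- Sets are the elements of Aczel's cumulative hierarchy V.  Set-theoretic
-- equality is the bisimulation _≐_.  Together with ExcludedMiddle (suc 0ℓ) and
-- Choice (at the end of this part), V satisfies the axioms of ZFC.

data V : Set₁ where
  sup : (I : Set) → (I → V) → V

Ix : V → Set
Ix (sup I _) = I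

el : (A : V) → Ix A → V
el (sup _ f) = f

infix 4 _≐_ _∈_ _⊆_ _≤_ _≈_

_≐_ : V → V → Set
sup I f ≐ sup J g = (∀ i → Σ[ j ∈ J ] f i ≐ g j) × (∀ j → Σ[ i ∈ I ] f i ≐ g j)

≐-refl : ∀ {x} → x ≐ x
≐-refl {sup I f} = (λ i → i , ≐-refl) , (λ i → i , ≐-refl)

≐-sym : ∀ {x y} → x ≐ y → y ≐ x
≐-sym {sup I f} {sup J g} (p , q) =
  (λ j → proj₁ (q j) , ≐-sym (proj₂ (q j))) ,
  (λ i → proj₁ (p i) , ≐-sym (proj₂ (p i)))

≐-trans : ∀ {x y z} → x ≐ y → y ≐ z → x ≐ z
≐-trans {sup I f} {sup J g} {sup K h} (p , q) (r , s) =
  (λ i → let (j , e) = p i ; (k , e′) = r j in k , ≐-trans e e′) ,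
  (λ k → let (j , e′) = s k ; (i , e) = q j in i , ≐-trans e e′)

V-setoid : Setoid (suc 0ℓ) 0ℓ
V-setoid = record
  { Carrier       = V
  ; _≈_           = _≐_
  ; isEquivalence = record { refl = ≐-refl ; sym = ≐-sym ; trans = ≐-trans }
  }

_∈_ : V → V → Set
x ∈ A = Σ[ i ∈ Ix A ] x ≐ el A i

-- Quantifiers bounded by a set range over its indices, so they do not raise
-- the universe level (needed for the separation below).

All∈ : ∀ {ℓ} (A : V) → (V → Set ℓ) → Set ℓ
All∈ A P = ∀ i → P (el A i)

Ex∈ : ∀ {ℓ} (A : V) → (V → Set ℓ) → Set ℓ
Ex∈ A P = Σ[ i ∈ Ix A ] P (el A i)

infix 2 All∈ Ex∈
syntax All∈ A (λ x → P) = ∀[ x ∈ A ] P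
syntax Ex∈  A (λ x → P) = ∃[ x ∈ A ] P

_⊆_ : V → V → Set
x ⊆ y = ∀[ z ∈ x ] z ∈ y

separate : (A : V) → (V → Set) → V
separate A P = sup (Σ[ i ∈ Ix A ] P (el A i)) (λ p → el A (proj₁ p))

syntax separate A (λ x → P) = ⟨ x ∈ A ∣ P ⟩

infixl 7 _∩_
_∩_ : V → V → V
x ∩ y = ⟨ z ∈ x ∣ z ∈ y ⟩

-- Characteristic functions into Bool keep the power set small; under excluded
-- middle every subset arises this way (∈-𝒫).

𝒫 : V → V
𝒫 A = sup (Ix A → Bool)
          (λ χ → sup (Σ[ i ∈ Ix A ] χ i ≡ true) (λ p → el A (proj₁ p)))

∈-𝒫 : ExcludedMiddle 0ℓ → ∀ x A → x ⊆ A → x ∈ 𝒫 A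
∈-𝒫 em (sup I f) A x⊆A = χ , to , from
  where
  χ : Ix A → Bool
  χ j with em {P = el A j ∈ sup I f}
  ... | yes _ = true
  ... | no  _ = false

  χ-complete : ∀ j → el A j ∈ sup I f → χ j ≡ true
  χ-complete j m with em {P = el A j ∈ sup I f}
  ... | yes _ = refl
  ... | no ¬m = contradiction m ¬m

  χ-sound : ∀ j → χ j ≡ true → el A j ∈ sup I f
  χ-sound j e with em {P = el A j ∈ sup I f}
  χ-sound j e  | yes m = m
  χ-sound j () | no  _

  to : ∀ i → Σ[ p ∈ (Σ[ j ∈ Ix A ] χ j ≡ true) ] f i ≐ el A (proj₁ p)
  to i = let (j , e) = x⊆A i in (j , χ-complete j (i , ≐-sym e)) , e

  from : ∀ (p : Σ[ j ∈ Ix A ] χ j ≡ true) → Σ[ i ∈ I ] f i ≐ el A (proj₁ p)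
  from (j , c) = let (i , e) = χ-sound j c in i , ≐-sym e

-- A setoid function between El A and El B is the same thing as a function from
-- A to B in V: its graph is a set by replacement.

El : V → Setoid 0ℓ 0ℓ
El A = record
  { Carrier       = Ix A
  ; _≈_           = λ i j → el A i ≐ el A j
  ; isEquivalence = record { refl = ≐-refl ; sym = ≐-sym ; trans = ≐-trans }
  }

-- Every family of nonempty sets has a choice function.  The function must
-- respect _≐_, so this is not provable by projection.

Choice : Set₁
Choice = (A : V) → (∀[ x ∈ A ] Ix x) →
         Σ[ f ∈ Func (El A) V-setoid ] (∀ i → Func.to f i ∈ el A i)

-- Ordinals and cardinals are von Neumann's.

Transitive : V → Set
Transitive x = ∀[ y ∈ x ] y ⊆ x

Ordinal : V → Set
Ordinal α = Transitive α × (∀[ β ∈ α ] Transitive β)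

_≤_ : V → V → Set
α ≤ β = α ∈ β ⊎ α ≐ β

_≈_ : V → V → Set
x ≈ y = Bijection (El x) (El y)

Cardinal : V → Set
Cardinal κ = Ordinal κ × (∀[ α ∈ κ ] ¬ (α ≈ κ))

∣_∣<_ : V → V → Set
∣ x ∣< κ = ∃[ ν ∈ κ ] (Cardinal ν × x ≈ ν)

Infinite : V → Set
Infinite x = Injection (setoid ℕ) (El x)

Uncountable : V → Set
Uncountable x = ¬ Injection (El x) (setoid ℕ)

Regular : V → Set
Regular κ = Cardinal κ × Infinite κ ×
  (∀[ α ∈ κ ] ((f : Func (El α) (El κ)) →
    ∃[ β ∈ κ ] (∀ i → el κ (Func.to f i) ∈ β)))

LimitCardinal : V → Set
LimitCardinal κ = Cardinal κ ×
  (∀[ ν ∈ κ ] (Cardinal ν → ∃[ ρ ∈ κ ] (Cardinal ρ × ν ∈ ρ)))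

StrongLimit : V → Set
StrongLimit κ = Cardinal κ × (∀[ ν ∈ κ ] (Cardinal ν → ∣ 𝒫 ν ∣< κ))

WeaklyInaccessible : V → Set
WeaklyInaccessible κ = Uncountable κ × Regular κ × LimitCardinal κ

Inaccessible : V → Set
Inaccessible κ = Uncountable κ × Regular κ × StrongLimit κ

UnboundedIn : V → V → Set
UnboundedIn C δ = ∀[ α ∈ δ ] ∃[ β ∈ C ∩ δ ] α ∈ β

-- A nonempty δ with C ∩ δ unbounded in it is a limit ordinal.

Club : V → V → Set
Club κ C = C ⊆ κ × UnboundedIn C κ ×
  (∀[ δ ∈ κ ] (Ix δ → UnboundedIn C δ → δ ∈ C))

Stationary : V → V → Set₁
Stationary κ X = X ⊆ κ × ((C : V) → Club κ C → ∃[ α ∈ C ] α ∈ X)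

Mahlo : V → Set₁
Mahlo κ = Inaccessible κ × Stationary κ ⟨ ν ∈ κ ∣ Inaccessible ν ⟩

𝒫[_] : V → V → V
𝒫[ κ ] A = ⟨ x ∈ 𝒫 A ∣ ∣ x ∣< κ ⟩

Unbounded : (κ A S : V) → Set
Unbounded κ A S = ∀[ x ∈ 𝒫[ κ ] A ] ∃[ y ∈ S ] x ⊆ y

OneStationary : (κ A S : V) → Set₁
OneStationary κ A S =
  (T : V) → T ⊆ 𝒫[ κ ] A → Unbounded κ A T →
  ∃[ x ∈ S ] (WeaklyInaccessible (x ∩ κ) ×
              Unbounded (x ∩ κ) x (T ∩ 𝒫[ x ∩ κ ] x))

infix 8 _↑⟨_,_⟩_
_↑⟨_,_⟩_ : (S κ A B : V) → V
S ↑⟨ κ , A ⟩ B = ⟨ y ∈ 𝒫[ κ ] B ∣ y ∩ A ∈ S ⟩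

{-# OPTIONS --safe #-}

-- From right to left, the sets y with y ∩ λ₀ ∈ T are unbounded if T is, and
-- x ↦ x ∩ λ₀ takes a reflection point for them to one for T.
--
-- From left to right, choose F with y ⊆ F y ∈ T for all y.  Call t closed under
-- F relative to s if F y ⊆ t and ot (F y) ∈ t whenever y ⊆ t and ot y ∈ s ∩ κ
-- (order types replace cardinalities: ot u ∈ κ iff |u| < κ for regular κ), and
-- let H s be the least such t ⊇ s.  The set T₀ of all s = t ∩ λ₀ with t closed
-- relative to s is unbounded: along a continuous chain of length κ that absorbs
-- F y for every y contained in an earlier member, the stages α with
-- Z α ∩ κ ⊆ α form a club, and the stage of an inaccessible α in it is closed.
-- If X ∈ S reflects T₀ at μ = X ∩ κ, then x = ⋃ { H s : s ∈ T₀ ∩ 𝒫[ μ ] X }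
-- has x ∩ λ₀ = X, and it reflects T because H is monotone and every small y ⊆ x
-- lies in a single H s.

module Submission where

open import Defs
open import Level using (0ℓ; suc; Lift; lift; lower)
open import Axiom.ExcludedMiddle using (ExcludedMiddle)
open import Data.Empty using (⊥; ⊥-elim)
open import Data.Nat using (ℕ; zero) renaming (suc to 1+_)
open import Data.Product using (Σ; Σ-syntax; _×_; _,_; proj₁; proj₂)
open import Data.Sum using (_⊎_; inj₁; inj₂; [_,_])
open import Data.Unit using (⊤; tt)
open import Function.Base using (case_of_)
open import Function.Bundles using (Func; Injection; Bijection; _⇔_; mk⇔)
import Function.Construct.Composition as Compose
open import Function.Properties.Bijection using (Bijection⇒Inverse)
import Function.Properties.Inverse as Inverse
open import Relation.Binary.PropositionalEquality using (refl)
open import Relation.Nullary using (¬_; yes; no; contradiction)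
import Relation.Nullary.Decidable as Dec

infix 4 _∊_ _⊑_
infixr 6 _·_
infixl 6 _∪_

-- _∈_ and _⊆_ unfold to types from which Agda cannot recover their arguments;
-- these records make the arguments inferable.

record _∊_ (x A : V) : Set where
  constructor mem
  field ∊⇒∈ : x ∈ A
open _∊_

record _⊑_ (x y : V) : Set where
  constructor incl
  field at : ∀ i → el x i ∊ y
open _⊑_

∊-congˡ : ∀ {x y A} → x ≐ y → x ∊ A → y ∊ A
∊-congˡ e (mem (i , p)) = mem (i , ≐-trans (≐-sym e) p)

_·_ : ∀ {x y z} → x ⊑ y → z ∊ x → z ∊ y
s · mem (i , e) = ∊-congˡ (≐-sym e) (at s i)

el∊ : ∀ A i → el A i ∊ A
el∊ A i = mem (i , ≐-refl)

⊑-intro : ∀ {x y} → (∀ {z} → z ∊ x → z ∊ y) → x ⊑ y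
⊑-intro {x} h = incl λ i → h (el∊ x i)

⊆⇒⊑ : ∀ x y → x ⊆ y → x ⊑ y
⊆⇒⊑ x y s = incl λ i → mem (s i)

⊑⇒⊆ : ∀ {x y} → x ⊑ y → x ⊆ y
⊑⇒⊆ s i = ∊⇒∈ (at s i)

≐⇒⊑ : ∀ {x y} → x ≐ y → x ⊑ y
≐⇒⊑ {sup I f} {sup J g} (p , _) = incl λ i → mem (p i)

∊-congʳ : ∀ {x y a} → x ≐ y → a ∊ x → a ∊ y
∊-congʳ e m = ≐⇒⊑ e · m

⊑-refl : ∀ {x} → x ⊑ x
⊑-refl = ⊑-intro λ m → m

⊑-trans : ∀ {x y z} → x ⊑ y → y ⊑ z → x ⊑ z
⊑-trans p q = ⊑-intro λ m → q · p · m

⊑-antisym : ∀ {x y} → x ⊑ y → y ⊑ x → x ≐ y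
⊑-antisym {sup I f} {sup J g} p q =
  (λ i → ∊⇒∈ (at p i)) ,
  (λ j → let (i , e) = ∊⇒∈ (at q j) in i , ≐-sym e)

≐-ext : ∀ {x y} → (∀ {z} → z ∊ x → z ∊ y) → (∀ {z} → z ∊ y → z ∊ x) → x ≐ y
≐-ext p q = ⊑-antisym (⊑-intro p) (⊑-intro q)

-- If `x ∊ x`, the element `f i` equal to `x` is again a member of itself, so the recursion descends
-- along the tree of `x`.
∊-irrefl : ∀ {x} → ¬ x ∊ x
∊-irrefl {sup I f} m@(mem (i , e)) = ∊-irrefl (∊-congˡ e (∊-congʳ e m))

-- Separation, intersections, unions and power sets.

Respects : (V → Set) → Set₁
Respects P = ∀ {a b} → a ≐ b → P a → P b

Respects₂ : (V → V → Set) → Set₁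
Respects₂ R = ∀ {a a′ b b′} → a ≐ a′ → b ≐ b′ → R a b → R a′ b′

separate-intro : ∀ {A x} (P : V → Set) → Respects P → x ∊ A → P x → x ∊ separate A P
separate-intro P resp (mem (i , e)) p = mem ((i , resp e p) , e)

separate-⊑ : ∀ A P → separate A P ⊑ A
separate-⊑ A P = incl λ p → el∊ A (proj₁ p)

separate-elim : ∀ A {x} (P : V → Set) → Respects P → x ∊ separate A P → P x
separate-elim A P resp (mem ((_ , p) , e)) = resp (≐-sym e) p

∩-intro : ∀ {x y a} → a ∊ x → a ∊ y → a ∊ x ∩ y
∩-intro {x} {y} m n =
  separate-intro (_∈ y) (λ e p → ∊⇒∈ (∊-congˡ {A = y} e (mem p))) m (∊⇒∈ n)

∩-⊑ˡ : ∀ x y → x ∩ y ⊑ x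
∩-⊑ˡ x y = separate-⊑ x (_∈ y)

∩-⊑ʳ : ∀ x y → x ∩ y ⊑ y
∩-⊑ʳ x y = incl λ p → mem (proj₂ p)

∩-congˡ : ∀ {x x′} y → x ≐ x′ → x ∩ y ≐ x′ ∩ y
∩-congˡ {x} {x′} y e = ≐-ext
  (λ m → ∩-intro (∊-congʳ e (∩-⊑ˡ x y · m)) (∩-⊑ʳ x y · m))
  (λ m → ∩-intro (∊-congʳ (≐-sym e) (∩-⊑ˡ x′ y · m)) (∩-⊑ʳ x′ y · m))

_∪_ : V → V → V
x ∪ y = sup (Ix x ⊎ Ix y) [ el x , el y ]

∪-⊑ˡ : ∀ x y → x ⊑ x ∪ y
∪-⊑ˡ x y = incl λ i → mem (inj₁ i , ≐-refl)

∪-⊑ʳ : ∀ x y → y ⊑ x ∪ y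
∪-⊑ʳ x y = incl λ i → mem (inj₂ i , ≐-refl)

∪-elim : ∀ {x y a} → a ∊ x ∪ y → a ∊ x ⊎ a ∊ y
∪-elim (mem (inj₁ i , e)) = inj₁ (mem (i , e))
∪-elim (mem (inj₂ j , e)) = inj₂ (mem (j , e))

❴_❵ : V → V
❴ a ❵ = sup ⊤ λ _ → a

∊❴❵ : ∀ a → a ∊ ❴ a ❵
∊❴❵ a = mem (tt , ≐-refl)

❴❵-elim : ∀ {a b} → b ∊ ❴ a ❵ → b ≐ a
❴❵-elim (mem (_ , e)) = e

⋃ : V → (V → V) → V
⋃ A F = sup (Σ[ i ∈ Ix A ] Ix (F (el A i))) λ p → el (F (el A (proj₁ p))) (proj₂ p)

⋃-intro : ∀ A (F : V → V) → (∀ {a b} → a ≐ b → F a ≐ F b) →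
          ∀ {a b} → a ∊ A → b ∊ F a → b ∊ ⋃ A F
⋃-intro A F F-cong (mem (i , e)) m with ∊-congʳ (F-cong e) m
... | mem (j , e′) = mem ((i , j) , e′)

⋃-elim : ∀ A (F : V → V) {b} → b ∊ ⋃ A F → Σ[ a ∈ V ] a ∊ A × b ∊ F a
⋃-elim A F (mem ((i , j) , e)) = el A i , el∊ A i , mem (j , e)

𝒫-elim : ∀ {x} A → x ∊ 𝒫 A → x ⊑ A
𝒫-elim A (mem (χ , e)) = ⊑-trans (≐⇒⊑ e) (incl λ p → el∊ A (proj₁ p))

-- Bijections and equality of sets.

≈-sym : ∀ {x y} → x ≈ y → y ≈ x
≈-sym b = Inverse.Inverse⇒Bijection (Inverse.sym (Bijection⇒Inverse b))

≈-trans : ∀ x y z → x ≈ y → y ≈ z → x ≈ z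
≈-trans x y z = Compose.bijection

-- The map is read off from `total` by projection; `functional` makes it respect `_≐_`, so no choice
-- is involved.
≈-fromRelation : ∀ x y (Q : V → V → Set) →
  (∀ i → Σ[ j ∈ Ix y ] Q (el x i) (el y j)) →
  (∀ j → Σ[ i ∈ Ix x ] Q (el x i) (el y j)) →
  (∀ {a a′ b b′} → Q a b → Q a′ b′ → a ≐ a′ → b ≐ b′) →
  (∀ {a a′ b b′} → Q a b → Q a′ b′ → b ≐ b′ → a ≐ a′) → x ≈ y
≈-fromRelation x y Q total onto functional injective = record
  { to        = λ i → proj₁ (total i)
  ; cong      = λ {i} {j} → functional (proj₂ (total i)) (proj₂ (total j))
  ; bijective = (λ {i} {j} → injective (proj₂ (total i)) (proj₂ (total j))) ,
                λ j → let (i , q) = onto j in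
                  i , λ {k} → functional (proj₂ (total k)) q
  }

≐⇒≈ : ∀ {x y} → x ≐ y → x ≈ y
≐⇒≈ {x} {y} e = ≈-fromRelation x y _≐_
  (λ i → ∊⇒∈ (at (≐⇒⊑ e) i))
  (λ j → let (i , p) = ∊⇒∈ (at (≐⇒⊑ (≐-sym e)) j) in i , ≐-sym p)
  (λ p q r → ≐-trans (≐-sym p) (≐-trans r q))
  (λ p q r → ≐-trans p (≐-trans r (≐-sym q)))

-- Ordinals and cardinals up to `_≐_`.

record Ord (α : V) : Set₁ where
  field
    trans : ∀ {β γ} → γ ∊ β → β ∊ α → γ ∊ α
    elems : ∀ {β γ δ} → β ∊ α → δ ∊ γ → γ ∊ β → δ ∊ β
open Ord

Ordinal⇒Ord : ∀ α → Ordinal α → Ord α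
Ordinal⇒Ord α (t , te) = record
  { trans = λ { {β} m (mem (i , e)) → ⊆⇒⊑ _ α (t i) · ∊-congʳ e m }
  ; elems = λ { (mem (i , e)) p q → let (mem (j , e′)) = ∊-congʳ e q in
      ∊-congʳ (≐-sym e) (⊆⇒⊑ _ (el α i) (te i j) · ∊-congʳ e′ p) }
  }

Ord⇒Ordinal : ∀ {α} → Ord α → Ordinal α
Ord⇒Ordinal {α} o =
  (λ i → ⊑⇒⊆ (⊑-intro λ m → trans o m (el∊ α i))) ,
  (λ i j → ⊑⇒⊆ (⊑-intro λ m → elems o (el∊ α i) m (el∊ (el α i) j)))

Ord-∊ : ∀ {α β} → Ord α → β ∊ α → Ord β
Ord-∊ o m = record { trans = elems o m ; elems = λ n → elems o (trans o n m) }

Ord-cong : ∀ {α β} → α ≐ β → Ord α → Ord β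
Ord-cong e o = record
  { trans = λ m n → ∊-congʳ e (trans o m (∊-congʳ (≐-sym e) n))
  ; elems = λ n → elems o (∊-congʳ (≐-sym e) n)
  }

∊⇒⊑ : ∀ {α β} → Ord α → β ∊ α → β ⊑ α
∊⇒⊑ o m = ⊑-intro λ n → trans o n m

≤⇒⊑ : ∀ {α β} → Ord β → α ≤ β → α ⊑ β
≤⇒⊑ o (inj₁ m) = ∊⇒⊑ o (mem m)
≤⇒⊑ o (inj₂ e) = ≐⇒⊑ e

Cardinal-cong : ∀ α β → α ≐ β → Cardinal α → Cardinal β
Cardinal-cong α β e (o , c) =
  Ord⇒Ordinal (Ord-cong e (Ordinal⇒Ord α o)) ,
  λ j b → let (mem (i , p)) = ∊-congʳ (≐-sym e) (el∊ β j) in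
    c i (≈-trans (el α i) (el β j) α (≐⇒≈ (≐-sym p))
           (≈-trans (el β j) β α b (≐⇒≈ (≐-sym e))))

∣∣<-cong : ∀ x y κ μ → x ≐ y → κ ≐ μ → ∣ x ∣< κ → ∣ y ∣< μ
∣∣<-cong x y κ μ e d (k , c , b) =
  let (mem (m , p)) = ∊-congʳ d (el∊ κ k) in
  m , Cardinal-cong (el κ k) (el μ m) p c ,
  ≈-trans y x (el μ m) (≐⇒≈ (≐-sym e)) (≈-trans x (el κ k) (el μ m) b (≐⇒≈ p))

-- Small sets and regular ordinals.

record Bounded (κ : V) (Q : V → Set) : Set₁ where
  field
    bound  : V
    bound∊ : bound ∊ κ
    below  : ∀ {ξ} → ξ ∊ κ → Q ξ → ξ ∊ bound
open Bounded

-- For sets of ordinals x and regular κ, Small κ x is equivalent to |x| < κ.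
-- In this form closure under subsets, images and unions needs no cardinal
-- arithmetic.

record Small (κ x : V) : Set₁ where
  field
    collect : (R : V → V → Set) → Respects₂ R →
              (∀ {a} → a ∊ x → Bounded κ (R a)) →
              Σ[ β ∈ V ] β ∊ κ × (∀ {a ξ} → a ∊ x → ξ ∊ κ → R a ξ → ξ ∊ β)
open Small

Small-cong : ∀ {κ μ x} → κ ≐ μ → Small κ x → Small μ x
Small-cong e s .collect R resp b =
  let (β , m , h) = collect s R resp λ n → record
        { bound  = bound (b n)
        ; bound∊ = ∊-congʳ (≐-sym e) (bound∊ (b n))
        ; below  = λ p → below (b n) (∊-congʳ e p)
        }
  in β , ∊-congʳ e m , λ n p → h n (∊-congʳ (≐-sym e) p)

-- What the proof uses of a regular cardinal: a nonempty limit ordinal in which every family of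
-- bounded sets indexed by an element has a common bound.
record Reg (κ : V) : Set₁ where
  field
    ord      : Ord κ
    point    : V
    point∊   : point ∊ κ
    limit    : ∀ {ξ} → ξ ∊ κ → Σ[ β ∈ V ] β ∊ κ × ξ ∊ β
    smallElt : ∀ {ν} → ν ∊ κ → Small κ ν
open Reg

-- π u is the Mostowski collapse of a set u of ordinals.

π : V → V → V
π u (sup I g) = sup (Σ[ i ∈ I ] g i ∊ u) λ p → π u (g (proj₁ p))

ot : V → V
ot u = sup (Ix u) λ i → π u (el u i)

π-cong : ∀ {u v ξ η} → u ≐ v → ξ ≐ η → π u ξ ≐ π v η
π-cong {ξ = sup I f} {sup J g} e (p , q) =
  (λ { (i , m) → let (j , d) = p i in (j , ∊-congʳ e (∊-congˡ d m)) , π-cong e d }) ,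
  (λ { (j , m) → let (i , d) = q j in
         (i , ∊-congʳ (≐-sym e) (∊-congˡ (≐-sym d) m)) , π-cong e d })

π-intro : ∀ {u ξ η} → η ∊ ξ → η ∊ u → π u η ∊ π u ξ
π-intro {ξ = sup I f} (mem (i , e)) m = mem ((i , ∊-congˡ e m) , π-cong ≐-refl e)

π-elim : ∀ u ξ {ζ} → ζ ∊ π u ξ → Σ[ η ∈ V ] η ∊ ξ × η ∊ u × ζ ≐ π u η
π-elim u (sup I f) (mem ((i , m) , e)) = f i , el∊ (sup I f) i , m , e

ot-intro : ∀ {u a} → a ∊ u → π u a ∊ ot u
ot-intro (mem (i , e)) = mem (i , π-cong ≐-refl e)

ot-elim : ∀ u {ζ} → ζ ∊ ot u → Σ[ a ∈ V ] a ∊ u × ζ ≐ π u a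
ot-elim u (mem (i , e)) = el u i , el∊ u i , e

ot-mono : ∀ {u v} → u ≐ v → ot u ⊑ ot v
ot-mono {u} e = ⊑-intro λ m → let (a , p , d) = ot-elim u m in
  ∊-congˡ (≐-sym (≐-trans d (π-cong e ≐-refl))) (ot-intro (∊-congʳ e p))

ot-cong : ∀ {u v} → u ≐ v → ot u ≐ ot v
ot-cong e = ⊑-antisym (ot-mono e) (ot-mono (≐-sym e))

Ord-ot : ∀ {u} → (∀ {a} → a ∊ u → Ord a) → Ord (ot u)
Ord-ot {u} on = record
  { trans = λ m n →
      let (a , p , e)     = ot-elim u n
          (η , _ , q , d) = π-elim u a (∊-congʳ e m)
      in ∊-congˡ (≐-sym d) (ot-intro q)
  ; elems = λ m n l →
      let (a , p , e)      = ot-elim u m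
          (η , r , q , d)  = π-elim u a (∊-congʳ e l)
          (ζ , r′ , q′ , c) = π-elim u η (∊-congʳ d n)
      in ∊-congʳ (≐-sym e) (∊-congˡ (≐-sym c) (π-intro (trans (on p) r′ r) q′))
  }

module Classical (em : ExcludedMiddle 0ℓ) where

  𝒫-intro : ∀ {x A} → x ⊑ A → x ∊ 𝒫 A
  𝒫-intro {x} {A} s = mem (∈-𝒫 em x A (⊑⇒⊆ s))

  byContradiction : {P : Set} → (¬ P → ⊥) → P
  byContradiction {P} h with em {P = P}
  ... | yes p = p
  ... | no ¬p = ⊥-elim (h ¬p)

  -- Ordinals

  -- If no element of `α` is at or above `β` and none of `β` is at or above `α`, the comparisons of
  -- elements leave only inclusion in both directions.
  trichotomy-step : ∀ {α β} → Ord α → Ord β →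
    (∀ i → el α i ∊ β ⊎ el α i ≐ β ⊎ β ∊ el α i) →
    (∀ j → α ∊ el β j ⊎ α ≐ el β j ⊎ el β j ∊ α) →
    α ∊ β ⊎ α ≐ β ⊎ β ∊ α
  trichotomy-step {α} {β} oα oβ left right
    with em {P = ∃[ x ∈ α ] β ≤ x} | em {P = ∃[ y ∈ β ] α ≤ y}
  ... | yes (i , inj₁ m) | _ = inj₂ (inj₂ (trans oα (mem m) (el∊ α i)))
  ... | yes (i , inj₂ e) | _ = inj₂ (inj₂ (mem (i , e)))
  ... | no _ | yes (j , inj₁ m) = inj₁ (trans oβ (mem m) (el∊ β j))
  ... | no _ | yes (j , inj₂ e) = inj₁ (mem (j , e))
  ... | no ¬i | no ¬j = inj₂ (inj₁ (⊑-antisym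
    (incl λ i → case left i of λ
      { (inj₁ m) → m
      ; (inj₂ (inj₁ e)) → contradiction (i , inj₂ (≐-sym e)) ¬i
      ; (inj₂ (inj₂ m)) → contradiction (i , inj₁ (∊⇒∈ m)) ¬i })
    (incl λ j → case right j of λ
      { (inj₁ m) → contradiction (j , inj₁ (∊⇒∈ m)) ¬j
      ; (inj₂ (inj₁ e)) → contradiction (j , inj₂ e) ¬j
      ; (inj₂ (inj₂ m)) → m })))

  trichotomy : ∀ {α β} → Ord α → Ord β → α ∊ β ⊎ α ≐ β ⊎ β ∊ α
  trichotomy {α@(sup I f)} {β@(sup J g)} oα oβ = trichotomy-step oα oβ
    (λ i → trichotomy {f i} {β} (Ord-∊ oα (el∊ α i)) oβ)
    (λ j → trichotomy {α} {g j} oα (Ord-∊ oβ (el∊ β j)))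

  ≮⇒⊑ : ∀ {α β} → Ord α → Ord β → ¬ α ∊ β → β ⊑ α
  ≮⇒⊑ oα oβ n with trichotomy oα oβ
  ... | inj₁ m = contradiction m n
  ... | inj₂ (inj₁ e) = ≐⇒⊑ (≐-sym e)
  ... | inj₂ (inj₂ m) = ∊⇒⊑ oα m

  -- The search descends into elements of `β` as long as one satisfies `P`; it stops at an
  -- `∊`-minimal set, which for ordinals is the least one.
  least : (P : V → Set) → Respects P → ∀ β → P β →
          Σ[ γ ∈ V ] P γ × (∀ {δ} → δ ∊ γ → ¬ P δ)
  least P resp (sup I f) p with em {P = Σ[ i ∈ I ] P (f i)}
  ... | yes (i , q) = least P resp (f i) q
  ... | no n = sup I f , p , λ { (mem (i , e)) q → n (i , resp e q) }

  max : ∀ {κ α β} → Ord κ → α ∊ κ → β ∊ κ → Σ[ γ ∈ V ] γ ∊ κ × α ⊑ γ × β ⊑ γ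
  max {α = α} {β} o a b with em {P = α ∊ β}
  ... | yes m = β , b , ∊⇒⊑ (Ord-∊ o b) m , ⊑-refl
  ... | no n = α , a , ⊑-refl , ≮⇒⊑ (Ord-∊ o a) (Ord-∊ o b) n

  -- Small sets

  -- Allows `collect` to run on a relation cut down by a condition: where the condition fails there
  -- is nothing to bound, and the default `point r` serves.
  guard : ∀ {κ Q} {P : Set} → Reg κ → (P → Bounded κ Q) → Bounded κ (λ ξ → P × Q ξ)
  guard {P = P} r b with em {P = P}
  ... | yes p = record
    { bound = bound (b p) ; bound∊ = bound∊ (b p) ; below = λ m q → below (b p) m (proj₂ q) }
  ... | no n = record
    { bound = point r ; bound∊ = point∊ r ; below = λ _ q → contradiction (proj₁ q) n }

  Bounded-≐ : ∀ {κ} → Reg κ → ∀ a → Bounded κ (_≐ a)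
  Bounded-≐ {κ} r a with em {P = a ∊ κ}
  ... | yes m = let (β , b , l) = limit r m in record
    { bound = β ; bound∊ = b ; below = λ _ e → ∊-congˡ (≐-sym e) l }
  ... | no n = record
    { bound = point r ; bound∊ = point∊ r ; below = λ m e → contradiction (∊-congˡ e m) n }

  -- A family on `x` extends to `y` by the empty family outside `x`.
  Small-⊑ : ∀ {κ x y} → Reg κ → x ⊑ y → Small κ y → Small κ x
  Small-⊑ {x = x} r s sm .collect R resp b =
    let (β , m , h) = collect sm (λ a ξ → a ∊ x × R a ξ)
          (λ e d (p , q) → ∊-congˡ e p , resp e d q) (λ _ → guard r b)
    in β , m , λ p q t → h (s · p) q (p , t)

  -- Bounds are collected twice, first over the members of one `F a` and then over `a ∊ A`. Asking
  -- only that the `F a` cover `u` makes the lemma fit images as well as unions.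
  Small-⋃′ : ∀ {κ u} → Reg κ → ∀ A (F : V → V) → (∀ {a b} → a ≐ b → F a ⊑ F b) →
             Small κ A → (∀ {a} → a ∊ A → Small κ (F a)) →
             (∀ {b} → b ∊ u → Σ[ a ∈ V ] a ∊ A × b ∊ F a) → Small κ u
  Small-⋃′ {κ} {u} r A F F-cong sA sF cover .collect R resp b =
    let (β , m , h) = collect sA R′ resp′ bounded in
    β , m , λ p q t → let (a , p₁ , mem (i , e)) = cover p in
      h p₁ q (i , ∊-congˡ e p , resp e ≐-refl t)
    where
    R′ : V → V → Set
    R′ a ξ = ∃[ b ∈ F a ] b ∊ u × R b ξ
    resp′ : Respects₂ R′
    resp′ {a} e d (i , p , q) = let (mem (j , c)) = F-cong e · el∊ (F a) i in
      j , ∊-congˡ c p , resp c d q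
    bounded : ∀ {a} → a ∊ A → Bounded κ (R′ a)
    bounded {a} p =
      let (β , m , h) = collect (sF p) (λ b ξ → b ∊ u × R b ξ)
            (λ e d (p , q) → ∊-congˡ e p , resp e d q) (λ _ → guard r b)
      in record { bound = β ; bound∊ = m ; below = λ q (i , t) → h (el∊ (F a) i) q t }

  Small-⋃ : ∀ {κ} → Reg κ → ∀ A (F : V → V) → (∀ {a b} → a ≐ b → F a ≐ F b) →
            Small κ A → (∀ {a} → a ∊ A → Small κ (F a)) → Small κ (⋃ A F)
  Small-⋃ r A F F-cong sA sF =
    Small-⋃′ r A F (λ e → ≐⇒⊑ (F-cong e)) sA sF (⋃-elim A F)

  Small-subsingleton : ∀ {κ x} → Reg κ → (∀ {a b} → a ∊ x → b ∊ x → a ≐ b) → Small κ x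
  Small-subsingleton {x = x} r h .collect R resp b with em {P = Ix x}
  ... | yes i = bound (b (el∊ x i)) , bound∊ (b (el∊ x i)) ,
    λ p q t → below (b (el∊ x i)) q (resp (h p (el∊ x i)) ≐-refl t)
  ... | no n = point r , point∊ r , λ { (mem (i , _)) → contradiction i n }

  Small-❴❵ : ∀ {κ} → Reg κ → ∀ a → Small κ ❴ a ❵
  Small-❴❵ r a = Small-subsingleton r λ p q → ≐-trans (❴❵-elim p) (≐-sym (❴❵-elim q))

  Small-∪ : ∀ {κ x y} → Reg κ → Small κ x → Small κ y → Small κ (x ∪ y)
  Small-∪ {x = x} {y} r sx sy .collect R resp b =
    let (β , m , h) = collect sx R resp (λ p → b (∪-⊑ˡ x y · p))
        (γ , n , k) = collect sy R resp (λ p → b (∪-⊑ʳ x y · p))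
        (δ , o , β⊑δ , γ⊑δ) = max (ord r) m n
    in δ , o , λ p q t → case ∪-elim p of λ
      { (inj₁ p) → β⊑δ · h p q t
      ; (inj₂ p) → γ⊑δ · k p q t }

  -- The sets of values of `Q` at the single points `a ∊ x` cover `y`, and each has at most one
  -- element.
  Small-image : ∀ {κ x y} → Reg κ → (Q : V → V → Set) → Respects₂ Q →
                (∀ {b} → b ∊ y → Σ[ a ∈ V ] a ∊ x × Q a b) →
                (∀ {a b c} → b ∊ y → c ∊ y → Q a b → Q a c → b ≐ c) →
                Small κ x → Small κ y
  Small-image {x = x} {y} r Q resp onto functional sx =
    Small-⋃′ r x (λ a → ⟨ b ∈ y ∣ Q a b ⟩)
      (λ {a} {a′} e → ⊑-intro λ m → separate-intro (Q a′) (resp ≐-refl)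
        (separate-⊑ y (Q a) · m) (resp e ≐-refl (separate-elim y (Q a) (resp ≐-refl) m)))
      sx
      (λ {a} _ → Small-subsingleton r λ m n →
        functional (separate-⊑ y (Q a) · m) (separate-⊑ y (Q a) · n)
          (separate-elim y (Q a) (resp ≐-refl) m) (separate-elim y (Q a) (resp ≐-refl) n))
      (λ m → let (a , p , q) = onto m in a , p , separate-intro (Q a) (resp ≐-refl) m q)

  Small⇒bounded : ∀ {κ x} → Reg κ → Small κ x →
                  Σ[ β ∈ V ] β ∊ κ × (∀ {ξ} → ξ ∊ x → ξ ∊ κ → ξ ∊ β)
  Small⇒bounded r s =
    let (β , m , h) = collect s (λ a ξ → ξ ≐ a)
          (λ e d p → ≐-trans (≐-sym d) (≐-trans p e)) (λ _ → Bounded-≐ r _)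
    in β , m , λ p q → h p q ≐-refl

  -- Order types

  π-injective : ∀ {u a b} → (∀ {a} → a ∊ u → Ord a) → a ∊ u → b ∊ u →
                π u a ≐ π u b → a ≐ b
  π-injective on p q e with trichotomy (on p) (on q)
  ... | inj₁ m = ⊥-elim (∊-irrefl (∊-congˡ e (π-intro m p)))
  ... | inj₂ (inj₁ d) = d
  ... | inj₂ (inj₂ m) = ⊥-elim (∊-irrefl (∊-congˡ (≐-sym e) (π-intro m q)))

  ≈-ot : ∀ {u} → (∀ {a} → a ∊ u → Ord a) → u ≈ ot u
  ≈-ot {u} on = ≈-fromRelation u (ot u) (λ a b → a ∊ u × b ≐ π u a)
    (λ i → i , el∊ u i , ≐-refl)
    (λ i → i , el∊ u i , ≐-refl)
    (λ (_ , p) (_ , q) e → ≐-trans p (≐-trans (π-cong ≐-refl e) (≐-sym q)))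
    (λ (m , p) (n , q) e → π-injective on m n (≐-trans (≐-sym p) (≐-trans e q)))

  -- Otherwise `κ ⊑ ot u`. A common bound `β ∊ κ` of the collapse values in `κ` is then itself such
  -- a value, giving `β ∊ β`.
  Small⇒ot∊ : ∀ {κ u} → Reg κ → (∀ {a} → a ∊ u → Ord a) → Small κ u → ot u ∊ κ
  Small⇒ot∊ {κ} {u} r on s = byContradiction λ n →
    let (β , m , h) = collect s (λ a ξ → ξ ≐ π u a)
          (λ e d p → ≐-trans (≐-sym d) (≐-trans p (π-cong ≐-refl e)))
          (λ _ → Bounded-≐ r _)
        (a , p , e) = ot-elim u (≮⇒⊑ (Ord-ot on) (ord r) n · m)
    in ∊-irrefl (h p m e)

  ot∊⇒Small : ∀ {κ u} → Reg κ → (∀ {a} → a ∊ u → Ord a) → ot u ∊ κ → Small κ u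
  ot∊⇒Small {κ} {u} r on m = Small-image r (λ p a → p ≐ π u a)
    (λ e d p → ≐-trans (≐-sym e) (≐-trans p (π-cong ≐-refl d)))
    (λ {a} p → π u a , ot-intro p , ≐-refl)
    (λ m n p q → π-injective on m n (≐-trans (≐-sym p) q))
    (smallElt r m)

  -- The order type is an ordinal in `κ` in bijection with `u`; the least such ordinal is a cardinal
  -- by minimality.
  Small⇒∣∣< : ∀ {κ u} → Reg κ → (∀ {a} → a ∊ u → Ord a) → Small κ u → ∣ u ∣< κ
  Small⇒∣∣< {κ} {u} r on s =
    let (ν , (mem (k , e) , b) , min) = least (λ ν → ν ∊ κ × u ≈ ν)
          (λ {ν} {ν′} e (m , b) → ∊-congˡ e m , ≈-trans u ν ν′ b (≐⇒≈ e))
          (ot u) (Small⇒ot∊ r on s , ≈-ot on)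
        k∊κ = el∊ κ k
    in k ,
       (Ord⇒Ordinal (Ord-∊ (ord r) k∊κ) , λ i c →
         let i∊k = el∊ (el κ k) i in
         min (∊-congʳ (≐-sym e) i∊k)
             ( trans (ord r) i∊k k∊κ
             , ≈-trans u (el κ k) (el (el κ k) i) (≈-trans u ν (el κ k) b (≐⇒≈ e))
                 (≈-sym {el (el κ k) i} {el κ k} c))) ,
       ≈-trans u ν (el κ k) b (≐⇒≈ e)

  ∣∣<⇒Small : ∀ {κ x} → Reg κ → ∣ x ∣< κ → Small κ x
  ∣∣<⇒Small {κ} {x} r (k , _ , b) = Small-image r
    (λ p a → Σ[ i ∈ Ix x ] el x i ≐ a × el (el κ k) (to i) ≐ p)
    (λ e d (i , p , q) → i , ≐-trans p d , ≐-trans q e)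
    (λ { (mem (i , e)) → el (el κ k) (to i) , el∊ (el κ k) (to i) , i , ≐-sym e , ≐-refl })
    (λ _ _ (i , p , q) (j , p′ , q′) →
      ≐-trans (≐-sym p) (≐-trans (injective (≐-trans q (≐-sym q′))) p′))
    (smallElt r (el∊ κ k))
    where open Bijection b

  -- `StrongLimit` speaks of cardinals, so `z` is replaced by a cardinal `ν` in bijection with it.
  -- `Q` matches subsets of `ν` with the corresponding subsets of `z`, which exhibits `𝒫 z` as an
  -- image of `𝒫 ν`.
  Small-𝒫 : ∀ {κ z} → Reg κ → StrongLimit κ → (∀ {a} → a ∊ z → Ord a) →
            Small κ z → Small κ (𝒫 z)
  Small-𝒫 {κ} {z} r (_ , sl) on s with Small⇒∣∣< r on s
  ... | k , c , b = Small-image r Q Q-resp onto functional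
                      (∣∣<⇒Small {κ} {𝒫 ν} r (sl k c))
    where
    open Bijection b
    ν = el κ k
    Q : V → V → Set
    Q p a = ∀ i → (el z i ∊ a → el ν (to i) ∊ p) × (el ν (to i) ∊ p → el z i ∊ a)
    Q-resp : Respects₂ Q
    Q-resp e d q i = (λ m → ∊-congʳ e (proj₁ (q i) (∊-congʳ (≐-sym d) m))) ,
                     (λ m → ∊-congʳ d (proj₂ (q i) (∊-congʳ (≐-sym e) m)))
    functional : ∀ {p a c} → a ∊ 𝒫 z → c ∊ 𝒫 z → Q p a → Q p c → a ≐ c
    functional m n q q′ = ⊑-antisym (half m q q′) (half n q′ q)
      where
      half : ∀ {p a c} → a ∊ 𝒫 z → Q p a → Q p c → a ⊑ c
      half m q q′ = ⊑-intro λ l → let (mem (i , e)) = 𝒫-elim z m · l in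
        ∊-congˡ (≐-sym e) (proj₂ (q′ i) (proj₁ (q i) (∊-congˡ e l)))
    onto : ∀ {a} → a ∊ 𝒫 z → Σ[ p ∈ V ] p ∊ 𝒫 ν × Q p a
    onto {a} m = separate ν T , 𝒫-intro (separate-⊑ ν T) , λ i →
      (λ l → separate-intro T T-resp (el∊ ν (to i)) (i , ≐-refl , l)) ,
      (λ l → let (j , e , l′) = separate-elim ν T T-resp l in
        ∊-congˡ (injective e) l′)
      where
      T : V → Set
      T n = Σ[ i ∈ Ix z ] el ν (to i) ≐ n × el z i ∊ a
      T-resp : Respects T
      T-resp e (i , d , l) = i , ≐-trans d e , l

  -- Regular cardinals

  module _ {κ : V} (R : Regular κ) where
    private
      inf     = proj₁ (proj₂ R)
      bounded = proj₂ (proj₂ R)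

      oκ : Ord κ
      oκ = Ordinal⇒Ord κ (proj₁ (proj₁ R))

      -- The larger of two distinct elements of `κ` has an element.
      nonempty : Σ[ m ∈ Ix κ ] Ix (el κ m)
      nonempty with trichotomy (Ord-∊ oκ (el∊ κ (Injection.to inf 0)))
                               (Ord-∊ oκ (el∊ κ (Injection.to inf 1)))
      ... | inj₁ (mem (i , _)) = Injection.to inf 1 , i
      ... | inj₂ (inj₁ e) = case Injection.injective inf e of λ ()
      ... | inj₂ (inj₂ (mem (i , _))) = Injection.to inf 0 , i

    -- Regularity needs a map that respects `_≐_`, but the given bounds may depend on the names of
    -- elements. The least bound does not, so taking it avoids choice.
    Regular-Small : ∀ {ν} → ν ∊ κ → Small κ ν
    Regular-Small {ν} (mem (k , e)) .collect Q resp b =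
      let (m , h) = bounded k f in
      el κ m , el∊ κ m , λ { p (mem (j , d)) q →
        let (mem (i , c)) = ∊-congʳ e p in
        ∊-congˡ (≐-sym d) (trans (Ord-∊ oκ (el∊ κ m))
          (∊-congʳ (proj₂ (index i)) (proj₂ (proj₁ (proj₂ (leastBound i))) j (resp c d q)))
          (mem (h i))) }
      where
      α = el κ k
      IsBound : Ix α → V → Set
      IsBound i β = β ∊ κ × (∀ j → Q (el α i) (el κ j) → el κ j ∊ β)
      IsBound-resp : ∀ i → Respects (IsBound i)
      IsBound-resp i e (m , h) = ∊-congˡ e m , λ j q → ∊-congʳ e (h j q)
      leastBound : ∀ i → Σ[ γ ∈ V ] IsBound i γ × (∀ {δ} → δ ∊ γ → ¬ IsBound i δ)
      leastBound i =
        let b′ = b (∊-congʳ (≐-sym e) (el∊ α i)) in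
        least (IsBound i) (IsBound-resp i) (bound b′)
          (bound∊ b′ , λ j q → below b′ (el∊ κ j) q)
      index : ∀ i → Σ[ j ∈ Ix κ ] proj₁ (leastBound i) ≐ el κ j
      index i = ∊⇒∈ (proj₁ (proj₁ (proj₂ (leastBound i))))
      leastBound-cong : ∀ i j → el α i ≐ el α j →
                        proj₁ (leastBound i) ≐ proj₁ (leastBound j)
      leastBound-cong i j e with leastBound i | leastBound j
      ... | γ , (m , h) , min | γ′ , (m′ , h′) , min′
        with trichotomy (Ord-∊ oκ m) (Ord-∊ oκ m′)
      ... | inj₁ l = ⊥-elim (min′ l (m , λ l q → h l (resp (≐-sym e) ≐-refl q)))
      ... | inj₂ (inj₁ d) = d
      ... | inj₂ (inj₂ l) = ⊥-elim (min l (m′ , λ l q → h′ l (resp e ≐-refl q)))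
      f : Func (El α) (El κ)
      f = record
        { to   = λ i → proj₁ (index i)
        ; cong = λ {i} {j} d → ≐-trans (≐-sym (proj₂ (index i)))
                   (≐-trans (leastBound-cong i j d) (proj₂ (index j)))
        }

    Regular⇒Reg : Reg κ
    Regular⇒Reg = record
      { ord = oκ
      ; point = el κ (proj₁ nonempty)
      ; point∊ = el∊ κ (proj₁ nonempty)
      ; limit = λ { (mem (k , e)) →
          -- A constant map on a nonempty element of `κ` is bounded in `κ`, and its bound lies above
          -- the constant value.
          let (m , i) = nonempty
              (j , h) = bounded m (record { to = λ _ → k ; cong = λ _ → ≐-refl })
          in el κ j , el∊ κ j , ∊-congˡ (≐-sym e) (mem (h i)) }
      ; smallElt = Regular-Small
      }

  -- The infinite `ρ` holds a copy of the natural numbers inside an element of `κ`; its remaining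
  -- elements get an empty set to bound.
  bound-sequence : ∀ {κ ρ} → Reg κ → ρ ∊ κ → Infinite ρ → (b : ℕ → V) →
                   (∀ n → b n ∊ κ) → Σ[ β ∈ V ] β ∊ κ × (∀ n → b n ∊ β)
  bound-sequence {κ} {ρ} r m inf b b∊ =
    let (β , m , h) = collect (smallElt r m) Q
          (λ e d (n , p , q) → n , ≐-trans (≐-sym e) p , ≐-trans (≐-sym d) q)
          bounded
    in β , m , λ n → h (el∊ ρ (to n)) (b∊ n) (n , ≐-refl , ≐-refl)
    where
    open Injection inf using (to; injective)
    Q : V → V → Set
    Q p ξ = Σ[ n ∈ ℕ ] p ≐ el ρ (to n) × ξ ≐ b n
    bounded : ∀ {p} → p ∊ ρ → Bounded κ (Q p)
    bounded {p} _ with em {P = Σ[ n ∈ ℕ ] p ≐ el ρ (to n)}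
    ... | no ¬n = record { bound = point r ; bound∊ = point∊ r
                         ; below = λ { _ (n , e , _) → contradiction (n , e) ¬n } }
    ... | yes (n , e) = let (β , m , l) = limit r (b∊ n) in record
      { bound = β ; bound∊ = m
      ; below = λ { _ (n′ , e′ , d) → case injective (≐-trans (≐-sym e) e′) of λ
          { refl → ∊-congˡ (≐-sym d) l } } }

  -- Bounded subsets and 1-stationarity

  𝒫[]-intro : ∀ {κ A z} → Reg κ → (∀ {a} → a ∊ z → Ord a) → z ⊑ A → Small κ z →
              z ∊ 𝒫[ κ ] A
  𝒫[]-intro {κ} r on s sm =
    separate-intro (∣_∣< κ) (λ {a} {b} e → ∣∣<-cong a b κ κ e ≐-refl)
      (𝒫-intro s) (Small⇒∣∣< r on sm)

  𝒫[]-elim : ∀ {κ z} A → Reg κ → z ∊ 𝒫[ κ ] A → z ⊑ A × Small κ z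
  𝒫[]-elim {κ} {z} A r m =
    𝒫-elim A (separate-⊑ (𝒫 A) (∣_∣< κ) · m) ,
    ∣∣<⇒Small {κ} {z} r (separate-elim (𝒫 A) (∣_∣< κ)
      (λ {a} {b} e → ∣∣<-cong a b κ κ e ≐-refl) m)

  -- Unboundedness phrased with `Small` and with arbitrary sets in place of indices, so that it can
  -- be applied up to `_≐_`.
  record Cofinal (κ A T : V) : Set₁ where
    field cover : ∀ {z} → z ⊑ A → Small κ z → Σ[ y ∈ V ] y ∊ T × z ⊑ y
  open Cofinal

  Unbounded⇒Cofinal : ∀ {κ A T} → Reg κ → (∀ {a} → a ∊ A → Ord a) →
                      Unbounded κ A T → Cofinal κ A T
  Unbounded⇒Cofinal {κ} {A} {T} r on u .cover {z} s sm =
    let (mem (i , e)) = 𝒫[]-intro r (λ m → on (s · m)) s sm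
        (k , c) = u i
    in el T k , el∊ T k , ⊑-trans (≐⇒⊑ e) (⊆⇒⊑ _ (el T k) c)

  Cofinal⇒Unbounded : ∀ {κ A T} → Reg κ → Cofinal κ A T → Unbounded κ A T
  Cofinal⇒Unbounded {κ} {A} {T} r c i =
    let (s , sm) = 𝒫[]-elim A r (el∊ (𝒫[ κ ] A) i)
        (y , mem (k , e) , l) = cover c s sm
    in k , ⊑⇒⊆ (⊑-trans l (≐⇒⊑ e))

  -- `μ` is only equal to `x ∩ κ` up to `_≐_`, so the transfer can keep one `μ` while `x` changes,
  -- without transporting weak inaccessibility.
  Reflects : (κ S T : V) → Set₁
  Reflects κ S T = Σ[ x ∈ V ] Σ[ μ ∈ V ] x ∊ S × μ ≐ x ∩ κ × WeaklyInaccessible μ ×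
    Cofinal μ x (T ∩ 𝒫[ μ ] x)

  OneStat : (κ A S : V) → Set₁
  OneStat κ A S = (T : V) → T ⊑ 𝒫[ κ ] A → Cofinal κ A T → Reflects κ S T

  WI⇒Reg : ∀ {μ} → WeaklyInaccessible μ → Reg μ
  WI⇒Reg (_ , r , _) = Regular⇒Reg r

  WI-cong : ∀ μ μ′ → μ ≐ μ′ → WeaklyInaccessible μ → WeaklyInaccessible μ′
  WI-cong μ μ′ e (unc , (c , inf , reg) , _ , lim) =
    (λ inj → unc (Compose.injection (Bijection.injection (≐⇒≈ e)) inj)) ,
    (c′ , Compose.injection inf (Bijection.injection (≐⇒≈ e)) , reg′) ,
    c′ , lim′
    where
    c′ = Cardinal-cong μ μ′ e c
    shift : ∀ {x y} → x ≐ y → (i : Ix x) → Σ[ j ∈ Ix y ] el x i ≐ el y j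
    shift d i = ∊⇒∈ (at (≐⇒⊑ d) i)
    reg′ : ∀ m′ (f : Func (El (el μ′ m′)) (El μ′)) →
           ∃[ β ∈ μ′ ] (∀ i → el μ′ (Func.to f i) ∈ β)
    reg′ m′ f =
      let (m , d) = shift (≐-sym e) m′
          (k , h) = reg m record
            { to   = λ i → proj₁ (shift (≐-sym e) (Func.to f (proj₁ (shift (≐-sym d) i))))
            ; cong = λ {i} {j} p → ≐-trans (≐-sym (proj₂ (shift (≐-sym e) _)))
                (≐-trans (Func.cong f (≐-trans (≐-sym (proj₂ (shift (≐-sym d) i)))
                                        (≐-trans p (proj₂ (shift (≐-sym d) j)))))
                         (proj₂ (shift (≐-sym e) _)))
            }
          (k′ , q) = shift e k
      in k′ , λ i →
        let (j , p) = shift d i in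
        ∊⇒∈ (∊-congʳ q (∊-congˡ
          (≐-trans (≐-sym (proj₂ (shift (≐-sym e) _)))
            (Func.cong f (≐-trans (≐-sym (proj₂ (shift (≐-sym d) j))) (≐-sym p))))
          (mem {A = el μ k} (h j))))
    lim′ : ∀ k′ → Cardinal (el μ′ k′) → ∃[ ρ ∈ μ′ ] (Cardinal ρ × el μ′ k′ ∈ ρ)
    lim′ k′ c =
      let (k , d) = shift (≐-sym e) k′
          (j , cj , m) = lim k (Cardinal-cong (el μ′ k′) (el μ k) d c)
          (j′ , q) = shift e j
      in j′ , Cardinal-cong (el μ j) (el μ′ j′) q cj ,
         ∊⇒∈ (∊-congʳ q (∊-congˡ (≐-sym d) (mem {A = el μ j} m)))

  OneStationary⇒OneStat : ∀ {κ A S} → Reg κ → (∀ {a} → a ∊ A → Ord a) →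
    S ⊑ 𝒫[ κ ] A → OneStationary κ A S → OneStat κ A S
  OneStationary⇒OneStat {κ} {A} {S} r on S⊑ os T T⊑ c =
    let (k , wi , u) = os T (⊑⇒⊆ T⊑) (Cofinal⇒Unbounded r c)
        X = el S k
        X⊑A = proj₁ (𝒫[]-elim A r (at S⊑ k))
    in X , X ∩ κ , el∊ S k , ≐-refl , wi ,
       Unbounded⇒Cofinal (WI⇒Reg wi) (λ m → on (X⊑A · m)) u

  OneStat⇒OneStationary : ∀ {κ A S} → Reg κ → (∀ {a} → a ∊ A → Ord a) →
    S ⊑ 𝒫[ κ ] A → OneStat κ A S → OneStationary κ A S
  OneStat⇒OneStationary {κ} {A} {S} r on S⊑ os T T⊆ u
    with os T (⊆⇒⊑ T (𝒫[ κ ] A) T⊆) (Unbounded⇒Cofinal r on u)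
  ... | x , μ , mem (k , e) , d , wi , c = k , wi′ , Cofinal⇒Unbounded r′ c′
    where
    X = el S k
    μ≐ : μ ≐ X ∩ κ
    μ≐ = ≐-trans d (∩-congˡ κ e)
    wi′ = WI-cong μ (X ∩ κ) μ≐ wi
    r′ = WI⇒Reg wi′
    X⊑A = proj₁ (𝒫[]-elim A r (at S⊑ k))
    c′ : Cofinal (X ∩ κ) X (T ∩ 𝒫[ X ∩ κ ] X)
    c′ .cover s sm =
      let (y , m , l) = cover c (⊑-trans s (≐⇒⊑ (≐-sym e))) (Small-cong (≐-sym μ≐) sm)
          (y⊑ , ysm)  = 𝒫[]-elim x (WI⇒Reg wi) (∩-⊑ʳ T (𝒫[ μ ] x) · m)
          y⊑X         = ⊑-trans y⊑ (≐⇒⊑ e)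
      in y , ∩-intro (∩-⊑ˡ T (𝒫[ μ ] x) · m)
               (𝒫[]-intro r′ (λ m → on (X⊑A · y⊑X · m)) y⊑X (Small-cong μ≐ ysm)) , l

  -- Choice functions and closure points of countable iterations.

  choose : Choice → (A B : V) (R : V → V → Set) → Respects₂ R →
    (∀ {a} → a ∊ A → Σ[ b ∈ V ] b ∊ B × R a b) →
    Σ[ F ∈ (V → V) ] (∀ {a a′} → a ≐ a′ → F a ≐ F a′) ×
      (∀ {a} → a ∊ A → F a ∊ B × R a (F a))
  choose ac A B R resp total = F , F-cong , spec
    where
    family : V
    family = sup (Ix A) λ i → ⟨ b ∈ B ∣ R (el A i) b ⟩
    -- Equal elements of `A` have equal sets of admissible values, so the picked value depends on
    -- the element and not on its index.
    picked = ac family λ i →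
      let (b , mem (k , e) , q) = total (el∊ A i) in k , resp ≐-refl e q
    f : Ix A → V
    f = Func.to (proj₁ picked)
    f∊ : ∀ i → f i ∊ ⟨ b ∈ B ∣ R (el A i) b ⟩
    f∊ i = mem (proj₂ picked i)
    f-cong : ∀ i j → el A i ≐ el A j → f i ≐ f j
    f-cong i j e = Func.cong (proj₁ picked) {i} {j}
      (≐-ext (change i j e) (change j i (≐-sym e)))
      where
      change : ∀ i j → el A i ≐ el A j → ∀ {b} →
        b ∊ ⟨ b ∈ B ∣ R (el A i) b ⟩ → b ∊ ⟨ b ∈ B ∣ R (el A j) b ⟩
      change i j e m = separate-intro (R (el A j)) (resp ≐-refl)
        (separate-⊑ B (R (el A i)) · m)
        (resp e ≐-refl (separate-elim B (R (el A i)) (resp ≐-refl) m))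
    -- The union of the (pairwise equal) values f i over all names i of a.
    F : V → V
    F a = sup (Σ[ i ∈ Ix A ] a ≐ el A i × Ix (f i)) λ (i , _ , k) → el (f i) k
    F-mono : ∀ {a a′} → a ≐ a′ → F a ⊑ F a′
    F-mono e = incl λ (i , d , k) → mem ((i , ≐-trans (≐-sym e) d , k) , ≐-refl)
    F-cong : ∀ {a a′} → a ≐ a′ → F a ≐ F a′
    F-cong e = ⊑-antisym (F-mono e) (F-mono (≐-sym e))
    F≐f : ∀ {a} i → a ≐ el A i → f i ≐ F a
    F≐f {a} i e = ⊑-antisym
      (incl λ k → mem ((i , e , k) , ≐-refl))
      (incl λ (j , d , k) → ∊-congʳ (f-cong j i (≐-trans (≐-sym d) e)) (el∊ (f j) k))
    spec : ∀ {a} → a ∊ A → F a ∊ B × R a (F a)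
    spec (mem (i , e)) =
      ∊-congˡ (F≐f i e) (separate-⊑ B (R (el A i)) · f∊ i) ,
      resp (≐-sym e) (F≐f i e) (separate-elim B (R (el A i)) (resp ≐-refl) (f∊ i))

  -- Minimality gives the last clause: some `b n` is missing from a `ξ ∊ β`, so `ξ` is at most
  -- `b n`.
  least-bound : ∀ {κ ρ} → Reg κ → ρ ∊ κ → Infinite ρ → (b : ℕ → V) →
    (∀ n → b n ∊ κ) →
    Σ[ β ∈ V ] β ∊ κ × (∀ n → b n ∊ β) × (∀ {ξ} → ξ ∊ β → Σ[ n ∈ ℕ ] ξ ⊑ b n)
  least-bound {κ} r ρ∊κ inf b b∊ with bound-sequence r ρ∊κ inf b b∊
  ... | β₀ , β₀∊ , ub₀
    with least (λ β → β ∊ κ × (∀ n → b n ∊ β))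
           (λ e (m , h) → ∊-congˡ e m , λ n → ∊-congʳ e (h n)) β₀ (β₀∊ , ub₀)
  ... | β , (β∊ , ub) , min = β , β∊ , ub , reached
    where
    reached : ∀ {ξ} → ξ ∊ β → Σ[ n ∈ ℕ ] ξ ⊑ b n
    reached {ξ} p with em {P = Σ[ n ∈ ℕ ] ¬ b n ∊ ξ}
    ... | no none = contradiction (trans (ord r) p β∊ , λ n →
            byContradiction λ q → none (n , q)) (min p)
    ... | yes (n , q) =
      n , ≮⇒⊑ (Ord-∊ (ord r) (b∊ n)) (Ord-∊ (ord r) (trans (ord r) p β∊)) q

  -- `β` is the least bound of the sequence that starts at `α` and repeats `step`.
  closure-point : ∀ {κ ρ α} → Reg κ → ρ ∊ κ → Infinite ρ → (P : V → V → Set₁) →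
    (∀ {ξ} → ξ ∊ κ → Σ[ γ ∈ V ] γ ∊ κ × ξ ∊ γ × P ξ γ) → α ∊ κ →
    Σ[ β ∈ V ] β ∊ κ × α ∊ β ×
      (∀ {ξ} → ξ ∊ β → Σ[ η ∈ V ] Σ[ γ ∈ V ] ξ ∊ η × γ ∊ β × P η γ)
  closure-point {κ} {ρ} {α} r ρ∊κ inf P step m = conclude (least-bound r ρ∊κ inf b b∊)
    where
    B : ℕ → Σ[ γ ∈ V ] γ ∊ κ
    B zero = α , m
    B (1+ n) = let (γ , p , _) = step (proj₂ (B n)) in γ , p
    b : ℕ → V
    b n = proj₁ (B n)
    b∊ : ∀ n → b n ∊ κ
    b∊ n = proj₂ (B n)
    rising : ∀ n → b n ∊ b (1+ n) × P (b n) (b (1+ n))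
    rising n = proj₂ (proj₂ (step (b∊ n)))
    conclude : Σ[ β ∈ V ] β ∊ κ × (∀ n → b n ∊ β) ×
                 (∀ {ξ} → ξ ∊ β → Σ[ n ∈ ℕ ] ξ ⊑ b n) →
      Σ[ β ∈ V ] β ∊ κ × α ∊ β ×
        (∀ {ξ} → ξ ∊ β → Σ[ η ∈ V ] Σ[ γ ∈ V ] ξ ∊ η × γ ∊ β × P η γ)
    conclude (β , β∊ , ub , near) = β , β∊ , ub 0 , λ {ξ} p →
      let (n , s) = near p in
      -- Only `ξ ⊑ b n` is known, so the strict `ξ ∊ η` forces the next term as `η` and the one
      -- after it as `γ`.
      b (1+ n) , b (1+ (1+ n)) , ⊑-∊ (trans (ord r) p β∊) (b∊ n) (b∊ (1+ n)) s (proj₁ (rising n)) ,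
      ub (1+ (1+ n)) , proj₂ (rising (1+ n))
      where
      ⊑-∊ : ∀ {ξ η γ} → ξ ∊ κ → η ∊ κ → γ ∊ κ → ξ ⊑ η → η ∊ γ → ξ ∊ γ
      ⊑-∊ ξ∊ η∊ γ∊ s l with trichotomy (Ord-∊ (ord r) ξ∊) (Ord-∊ (ord r) η∊)
      ... | inj₁ q = trans (Ord-∊ (ord r) γ∊) q l
      ... | inj₂ (inj₁ e) = ∊-congˡ (≐-sym e) l
      ... | inj₂ (inj₂ q) = ⊥-elim (∊-irrefl (s · q))

  -- Closure under a set operation

  module Closing {κ θ : V} (mahlo : Mahlo κ) (oθ : Ord θ) (G : V → V)
                 (G-cong : ∀ {y z} → y ≐ z → G y ≐ G z)
                 (G-⊑ : ∀ {y} → y ⊑ θ → Small κ y → G y ⊑ θ)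
                 (G-small : ∀ {y} → y ⊑ θ → Small κ y → Small κ (G y)) where
    private
      inaccessible = proj₁ mahlo
      stationary   = proj₂ (proj₂ mahlo)
      rκ : Reg κ
      rκ = Regular⇒Reg (proj₁ (proj₂ inaccessible))

    module Chain {x : V} (x⊑θ : x ⊑ θ) (x-small : Small κ x) where

      -- Z ξ adjoins to x all G y with y ⊆ Z η and η ∈ ξ.
      Z : V → V
      New : (I : Set) → (I → V) → V → Set
      Z (sup I g) = separate θ (λ a → a ∊ x ⊎ New I g a)
      New I g a = Σ[ i ∈ I ] ∃[ y ∈ 𝒫 (Z (g i)) ] a ∊ G y

      module _ (I : Set) (g : I → V) where
        In : V → Set
        In a = a ∊ x ⊎ New I g a
        In-resp : Respects In
        In-resp e (inj₁ m) = inj₁ (∊-congˡ e m)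
        In-resp e (inj₂ (i , k , m)) = inj₂ (i , k , ∊-congˡ e m)

      Z-⊑ : ∀ {ξ} → Z ξ ⊑ θ
      Z-⊑ {sup I g} = separate-⊑ θ (In I g)

      Z-ord : ∀ {ξ a} → a ∊ Z ξ → Ord a
      Z-ord m = Ord-∊ oθ (Z-⊑ · m)

      Z-elim : ∀ ξ {a} → a ∊ Z ξ →
        a ∊ x ⊎ Σ[ η ∈ V ] Σ[ y ∈ V ] η ∊ ξ × y ⊑ Z η × a ∊ G y
      Z-elim (sup I g) m with separate-elim θ (In I g) (In-resp I g) m
      ... | inj₁ n = inj₁ n
      ... | inj₂ (i , k , n) =
        inj₂ (g i , el (𝒫 (Z (g i))) k , el∊ (sup I g) i ,
              𝒫-elim (Z (g i)) (el∊ (𝒫 (Z (g i))) k) , n)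

      Z-base : ∀ {ξ} → x ⊑ Z ξ
      Z-base {sup I g} = ⊑-intro λ m →
        separate-intro (In I g) (In-resp I g) (x⊑θ · m) (inj₁ m)

      Z-mono : ∀ ξ ξ′ → ξ ⊑ ξ′ → Z ξ ⊑ Z ξ′
      Z-mono (sup I g) (sup J h) s = ⊑-intro λ m →
        separate-intro (In J h) (In-resp J h) (separate-⊑ θ (In I g) · m)
          (case separate-elim θ (In I g) (In-resp I g) m of λ
            { (inj₁ n) → inj₁ n
            ; (inj₂ (i , k , n)) →
              let (j , e) = ∊⇒∈ (at s i)
                  (mem (l , d)) = 𝒫-intro (⊑-trans (𝒫-elim (Z (g i)) (el∊ (𝒫 (Z (g i))) k))
                                    (Z-mono (g i) (h j) (≐⇒⊑ e)))
              in inj₂ (j , l , ∊-congʳ (G-cong d) n) })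

      Z-intro : ∀ {ξ η y a} → a ∊ θ → η ∊ ξ → y ⊑ Z η → a ∊ G y → a ∊ Z ξ
      Z-intro {sup I g} {η} a∊ (mem (i , e)) s m =
        let (mem (k , d)) = 𝒫-intro (⊑-trans s (Z-mono η (g i) (≐⇒⊑ e)))
        in separate-intro (In I g) (In-resp I g) a∊ (inj₂ (i , k , ∊-congʳ (G-cong d) m))

      -- `x` together with the `Next η` for `η ∊ ξ` covers `Z ξ`; this is how the size of a stage is
      -- bounded.
      Next : V → V
      Next η = ⋃ (𝒫 (Z η)) G

      Next-mono : ∀ {η η′} → η ≐ η′ → Next η ⊑ Next η′
      Next-mono {η} {η′} e = ⊑-intro λ m →
        let (y , p , q) = ⋃-elim (𝒫 (Z η)) G m in
        ⋃-intro (𝒫 (Z η′)) G G-cong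
          (𝒫-intro (⊑-trans (𝒫-elim (Z η) p) (Z-mono η η′ (≐⇒⊑ e)))) q

      -- By induction on `ξ`: an earlier stage has few subsets because `κ` is a strong limit, each
      -- contributes a small set, and regularity bounds the unions.
      Z-small : ∀ ξ → ξ ∊ κ → Small κ (Z ξ)
      Z-small ξ@(sup I g) m = Small-⊑ rκ
        (⊑-intro λ {a} n → case Z-elim ξ n of λ
          { (inj₁ n) → ∪-⊑ˡ x U · n
          ; (inj₂ (η , y , p , q , n)) → ∪-⊑ʳ x U ·
              ⋃-intro ξ Next Next-cong p (⋃-intro (𝒫 (Z η)) G G-cong (𝒫-intro q) n) })
        (Small-∪ rκ x-small (Small-⋃ rκ ξ Next Next-cong (smallElt rκ m) next-small))
        where
        U = ⋃ ξ Next
        Next-cong : ∀ {η η′} → η ≐ η′ → Next η ≐ Next η′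
        Next-cong e = ⊑-antisym (Next-mono e) (Next-mono (≐-sym e))
        next-small : ∀ {η} → η ∊ ξ → Small κ (Next η)
        next-small (mem (i , e)) = Small-⊑ rκ (Next-mono e)
          (Small-⋃ rκ (𝒫 (Z (g i))) G G-cong
            (Small-𝒫 rκ (proj₂ (proj₂ inaccessible)) (Z-ord {g i}) sZ)
            λ p → G-small (⊑-trans (𝒫-elim (Z (g i)) p) (Z-⊑ {g i}))
                    (Small-⊑ rκ (𝒫-elim (Z (g i)) p) sZ))
          where sZ = Z-small (g i) (trans (ord rκ) (el∊ ξ i) m)

      -- At such a stage every order type below `κ` that occurs in `Z α` is below `α`; for regular
      -- `α`, a set of ordinals with that order type is then small for `α`.
      ClosedAt : V → Set
      ClosedAt α = Z α ∩ κ ⊑ α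

      ClosedAt-resp : Respects ClosedAt
      ClosedAt-resp {α} {β} e s = ⊑-intro λ m → ∊-congʳ e
        (s · ∩-intro (Z-mono β α (≐⇒⊑ (≐-sym e)) · ∩-⊑ˡ (Z β) κ · m) (∩-⊑ʳ (Z β) κ · m))

      C : V
      C = separate κ ClosedAt

      κ-club : Club κ κ
      κ-club =
        (λ i → ∊⇒∈ (el∊ κ i)) ,
        (λ i → let (β , m , l) = limit rκ (el∊ κ i)
                   (mem (j , e)) = ∩-intro m m in
               j , ∊⇒∈ (∊-congʳ e l)) ,
        (λ i _ _ → ∊⇒∈ (el∊ κ i))

      -- Mahlo κ has an infinite element, so ω-sequences in κ are bounded.
      infinite-element : Σ[ ρ ∈ V ] ρ ∊ κ × Infinite ρ
      infinite-element with stationary κ κ-club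
      ... | _ , (k , _ , (_ , inf , _) , _) , _ = el κ k , el∊ κ k , inf

      step : ∀ {ξ} → ξ ∊ κ →
             Σ[ γ ∈ V ] γ ∊ κ × ξ ∊ γ × (∀ {a} → a ∊ Z ξ → a ∊ κ → a ∊ γ)
      step m with Small⇒bounded rκ (Z-small _ m) | limit rκ m
      ... | β , p , h | γ , q , l with max (ord rκ) p q
      ... | δ , r , s , t = δ , r , t · l , λ n n′ → s · h n n′

      -- At a closure point `β` of `step`, an element of `Z β ∩ κ` enters at a stage below `β`, and
      -- a later element of `β` bounds it.
      C-above : ∀ {α} → α ∊ κ → Σ[ β ∈ V ] β ∊ C × α ∊ β
      C-above {α} m =
        let (ρ , ρ∊κ , inf) = infinite-element in
        conclude (closure-point rκ ρ∊κ inf Absorbs step m)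
        where
        Absorbs : V → V → Set₁
        Absorbs ξ γ = ∀ {a} → a ∊ Z ξ → a ∊ κ → a ∊ γ
        conclude : Σ[ β ∈ V ] β ∊ κ × α ∊ β ×
          (∀ {ξ} → ξ ∊ β → Σ[ η ∈ V ] Σ[ γ ∈ V ] ξ ∊ η × γ ∊ β × Absorbs η γ) →
          Σ[ β ∈ V ] β ∊ C × α ∊ β
        conclude (β , β∊κ , α∊β , reached) =
          β , separate-intro ClosedAt ClosedAt-resp β∊κ (⊑-intro closed) , α∊β
          where
          enter : ∀ {ξ a} → ξ ∊ β → (∀ {η} → ξ ∊ η → a ∊ Z η) → a ∊ κ → a ∊ β
          enter p h q = let (η , γ , l , γ∊β , absorbs) = reached p in
            trans (Ord-∊ (ord rκ) β∊κ) (absorbs (h l) q) γ∊β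
          closed : ∀ {a} → a ∊ Z β ∩ κ → a ∊ β
          closed {a} q = case Z-elim β (∩-⊑ˡ (Z β) κ · q) of λ
            -- Elements of `x` lie in every stage; `α` merely serves as some element of `β`.
            { (inj₁ r) → enter α∊β (λ _ → Z-base · r) (∩-⊑ʳ (Z β) κ · q)
            ; (inj₂ (ξ , y , r , s , t)) →
                enter r (λ l → Z-intro (Z-⊑ {β} · ∩-⊑ˡ (Z β) κ · q) l s t)
                  (∩-⊑ʳ (Z β) κ · q) }

      C-club : Club κ C
      C-club =
        ⊑⇒⊆ C⊑ ,
        (λ i → let (β , m , l) = C-above (el∊ κ i)
                   (mem (j , e)) = ∩-intro m (C⊑ · m) in
               j , ∊⇒∈ (∊-congʳ e l)) ,
        (λ d j u → ∊⇒∈ (separate-intro ClosedAt ClosedAt-resp (el∊ κ d)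
          (⊑-intro λ {a} q → limit-closed d j u q)))
        where
        C⊑ : C ⊑ κ
        C⊑ = separate-⊑ κ ClosedAt
        -- An element of `Z δ ∩ κ` already lies in `Z γ` for some `γ ∊ C ∩ δ`, hence in `γ` because
        -- `γ` is closed. The given index `j` provides such a `γ` for elements of `x`.
        limit-closed : ∀ d → Ix (el κ d) → UnboundedIn C (el κ d) →
                       ∀ {a} → a ∊ Z (el κ d) ∩ κ → a ∊ el κ d
        limit-closed d j u q = case Z-elim δ (∩-⊑ˡ (Z δ) κ · q) of λ
          { (inj₁ r) → enter (proj₁ (u j)) (Z-base · r)
          ; (inj₂ (η , y , mem (i , e) , s , t)) → let (k , l) = u i in
              enter k (Z-intro (Z-⊑ {δ} · ∩-⊑ˡ (Z δ) κ · q)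
                        (∊-congˡ (≐-sym e) (mem {A = el (C ∩ δ) k} l)) s t) }
          where
          δ = el κ d
          a∊κ = ∩-⊑ʳ (Z δ) κ · q
          enter : ∀ k → _ ∊ Z (el (C ∩ δ) k) → _ ∊ δ
          enter k r = trans (Ord-∊ (ord rκ) (el∊ κ d))
            (separate-elim κ ClosedAt ClosedAt-resp
               (∩-⊑ˡ C δ · el∊ (C ∩ δ) k) · ∩-intro r a∊κ)
            (∩-⊑ʳ C δ · el∊ (C ∩ δ) k)

      inaccessible-closed : Σ[ ν ∈ V ] ν ∊ κ × Reg ν × ClosedAt ν
      inaccessible-closed =
        let (k , (l , _ , R , _) , e) = stationary C C-club in
        el κ l , el∊ κ l , Regular⇒Reg R ,
        ClosedAt-resp e (separate-elim κ ClosedAt ClosedAt-resp (el∊ C k))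

      Closure : Set₁
      Closure = Σ[ t ∈ V ] x ⊑ t × t ⊑ θ × Small κ t ×
        (∀ {y} → y ⊑ t → ot y ∊ t → ot y ∊ κ → G y ⊑ t)

      closure : Closure
      closure = conclude inaccessible-closed
        where
        conclude : (Σ[ ν ∈ V ] ν ∊ κ × Reg ν × ClosedAt ν) → Closure
        conclude (ν , ν∊κ , rν , ν-closed) = Z ν , Z-base , Z-⊑ , sZ , closed
          where
          sZ = Z-small ν ν∊κ
          -- Continuity of the chain at the limit `ν`: what stage `η` contributes is present at any
          -- later `ξ ∊ ν`.
          reached : ∀ {a} → a ∊ Z ν → Σ[ ξ ∈ V ] ξ ∊ ν × a ∊ Z ξ
          reached m = case Z-elim ν m of λ
            { (inj₁ n) → point rν , point∊ rν , Z-base · n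
            ; (inj₂ (η , y , p , q , n)) → let (ξ , r , s) = limit rν p in
                ξ , r , Z-intro (Z-⊑ {ν} · m) s q n }
          closed : ∀ {y} → y ⊑ Z ν → ot y ∊ Z ν → ot y ∊ κ → G y ⊑ Z ν
          closed {y} s p q =
            -- For each `a ∊ y` the stages that still miss `a` are bounded in `ν`, and `y` is small
            -- for `ν`. A common bound `β` misses no element of `y`, as otherwise `β ∊ β`.
            let (β , β∊ , h) = collect sy (λ a ξ → ¬ a ∊ Z ξ)
                  (λ {_} {_} {ξ} {ξ′} e d n m → n (∊-congˡ (≐-sym e)
                     (Z-mono ξ′ ξ (≐⇒⊑ (≐-sym d)) · m)))
                  (λ {a} m → let (ξ , ξ∊ , r) = reached (s · m) in record
                    { bound = ξ ; bound∊ = ξ∊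
                    ; below = λ {η} η∊ n → byContradiction λ η∉ →
                        n (Z-mono ξ η (≮⇒⊑ (Ord-∊ (ord rν) η∊) (Ord-∊ (ord rν) ξ∊) η∉) · r) })
                y⊑Zβ = ⊑-intro λ m → byContradiction λ n → ∊-irrefl (h m β∊ n)
            in ⊑-intro λ m → Z-intro
                 (G-⊑ (⊑-trans s (Z-⊑ {ν})) (Small-⊑ rκ s sZ) · m) β∊ y⊑Zβ m
            where
            sy : Small ν y
            sy = ot∊⇒Small rν (λ m → Z-ord {ν} (s · m)) (ν-closed · ∩-intro p q)

  -- Transfer between 𝒫[ κ ] θ and 𝒫[ κ ] θ′

  module Transfer (ac : Choice) {κ θ θ′ : V} (mahlo : Mahlo κ)
                  (oθ : Ord θ) (oθ′ : Ord θ′) (κ⊑θ : κ ⊑ θ) (θ⊑θ′ : θ ⊑ θ′) where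
    private
      rκ : Reg κ
      rκ = Regular⇒Reg (proj₁ (proj₂ (proj₁ mahlo)))

      κ⊑θ′ : κ ⊑ θ′
      κ⊑θ′ = ⊑-trans κ⊑θ θ⊑θ′

      on : ∀ {y} → y ⊑ θ′ → ∀ {a} → a ∊ y → Ord a
      on s m = Ord-∊ oθ′ (s · m)

      ∩θ∈ : V → V → Set
      ∩θ∈ T y = y ∩ θ ∈ T

      ∩θ∈-resp : ∀ T → Respects (∩θ∈ T)
      ∩θ∈-resp T e m = ∊⇒∈ (∊-congˡ (∩-congˡ θ e) (mem {A = T} m))

    ↑-intro : ∀ {T y} → y ∊ 𝒫[ κ ] θ′ → y ∩ θ ∊ T → y ∊ T ↑⟨ κ , θ ⟩ θ′
    ↑-intro {T} m n = separate-intro (∩θ∈ T) (∩θ∈-resp T) m (∊⇒∈ n)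

    ↑-⊑ : ∀ T → T ↑⟨ κ , θ ⟩ θ′ ⊑ 𝒫[ κ ] θ′
    ↑-⊑ T = separate-⊑ (𝒫[ κ ] θ′) (∩θ∈ T)

    ↑-elim : ∀ T {y} → y ∊ T ↑⟨ κ , θ ⟩ θ′ → y ∩ θ ∊ T
    ↑-elim T m = mem (separate-elim (𝒫[ κ ] θ′) (∩θ∈ T) (∩θ∈-resp T) m)

    -- If `t ∊ T` covers `z ∩ θ`, then `z ∪ t` covers `z` and meets `θ` exactly in `t`.
    ↑-cofinal : ∀ {T} → T ⊑ 𝒫[ κ ] θ → Cofinal κ θ T → Cofinal κ θ′ (T ↑⟨ κ , θ ⟩ θ′)
    ↑-cofinal {T} T⊑ c .cover {z} s sm =
      let (t , t∊ , l)   = cover c (∩-⊑ʳ z θ) (Small-⊑ rκ (∩-⊑ˡ z θ) sm)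
          (t⊑θ , t-small) = 𝒫[]-elim θ rκ (T⊑ · t∊)
          w⊑ = ⊑-intro λ m → case ∪-elim m of λ
            { (inj₁ n) → s · n
            ; (inj₂ n) → θ⊑θ′ · t⊑θ · n }
          w∩θ≐t = ≐-ext
            (λ m → absorb l (∩-⊑ˡ (z ∪ t) θ · m) (∩-⊑ʳ (z ∪ t) θ · m))
            (λ m → ∩-intro (∪-⊑ʳ z t · m) (t⊑θ · m))
      in z ∪ t ,
         ↑-intro (𝒫[]-intro rκ (on w⊑) w⊑ (Small-∪ rκ sm t-small))
                 (∊-congˡ (≐-sym w∩θ≐t) t∊) ,
         ∪-⊑ˡ z t
      where
      absorb : ∀ {t a} → z ∩ θ ⊑ t → a ∊ z ∪ t → a ∊ θ → a ∊ t
      absorb l m n = case ∪-elim m of λ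
        { (inj₁ p) → l · ∩-intro {z} p n
        ; (inj₂ p) → p }

    down : ∀ {S} → OneStat κ θ′ (S ↑⟨ κ , θ ⟩ θ′) → OneStat κ θ S
    down {S} os T T⊑ c = conclude (os (T ↑⟨ κ , θ ⟩ θ′) (↑-⊑ T) (↑-cofinal T⊑ c))
      where
      conclude : Reflects κ (S ↑⟨ κ , θ ⟩ θ′) (T ↑⟨ κ , θ ⟩ θ′) → Reflects κ S T
      conclude (x , μ , x∊ , μ≐ , wi , cof) = x ∩ θ , μ , ↑-elim S x∊ , μ≐′ , wi , cof′
        where
        rμ : Reg μ
        rμ = WI⇒Reg wi
        μ≐′ : μ ≐ (x ∩ θ) ∩ κ
        μ≐′ = ≐-trans μ≐ (≐-ext
          (λ m → ∩-intro (∩-intro (∩-⊑ˡ x κ · m) (κ⊑θ · ∩-⊑ʳ x κ · m)) (∩-⊑ʳ x κ · m))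
          (λ m → ∩-intro (∩-⊑ˡ x θ · ∩-⊑ˡ (x ∩ θ) κ · m) (∩-⊑ʳ (x ∩ θ) κ · m)))
        cof′ : Cofinal μ (x ∩ θ) (T ∩ 𝒫[ μ ] (x ∩ θ))
        cof′ .cover s sm =
          let (y , m , l)     = cover cof (⊑-trans s (∩-⊑ˡ x θ)) sm
              T′              = T ↑⟨ κ , θ ⟩ θ′
              (y⊑x , y-small) = 𝒫[]-elim x rμ (∩-⊑ʳ T′ (𝒫[ μ ] x) · m)
          in y ∩ θ ,
             ∩-intro (↑-elim T (∩-⊑ˡ T′ (𝒫[ μ ] x) · m))
               (𝒫[]-intro rμ (λ n → Ord-∊ oθ (∩-⊑ʳ y θ · n))
                 (⊑-intro λ n → ∩-intro (y⊑x · ∩-⊑ˡ y θ · n) (∩-⊑ʳ y θ · n))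
                 (Small-⊑ rμ (∩-⊑ˡ y θ) y-small)) ,
             ⊑-intro λ n → ∩-intro (l · n) (∩-⊑ʳ x θ · s · n)

    -- The upward direction: closed sets, hulls and their traces on `θ`.

    module Up {T : V} (T⊑ : T ⊑ 𝒫[ κ ] θ′) (F : V → V)
              (F-cong : ∀ {y z} → y ≐ z → F y ≐ F z)
              (F-spec : ∀ {y} → y ∊ 𝒫[ κ ] θ′ → F y ∊ T × y ⊑ F y) where

      -- The order type of F y is adjoined so that sets closed under G know a bound on |F y|.
      G : V → V
      G y = F y ∪ ❴ ot (F y) ❵

      G-mono : ∀ {y z} → y ≐ z → G y ⊑ G z
      G-mono {y} {z} e = ⊑-intro λ m → case ∪-elim m of λ
        { (inj₁ n) → ∪-⊑ˡ (F z) ❴ ot (F z) ❵ · ∊-congʳ (F-cong e) n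
        ; (inj₂ n) → ∪-⊑ʳ (F z) ❴ ot (F z) ❵ ·
            ∊-congˡ (≐-sym (≐-trans (❴❵-elim n) (ot-cong (F-cong e)))) (∊❴❵ (ot (F z))) }

      G-cong : ∀ {y z} → y ≐ z → G y ≐ G z
      G-cong e = ⊑-antisym (G-mono e) (G-mono (≐-sym e))

      F∊T : ∀ {y} → y ⊑ θ′ → Small κ y → F y ∊ T × y ⊑ F y
      F∊T s sm = F-spec (𝒫[]-intro rκ (on s) s sm)

      F-bounded : ∀ {y} → y ⊑ θ′ → Small κ y → F y ⊑ θ′ × Small κ (F y)
      F-bounded s sm = 𝒫[]-elim θ′ rκ (T⊑ · proj₁ (F∊T s sm))

      otF∊κ : ∀ {y} → y ⊑ θ′ → Small κ y → ot (F y) ∊ κ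
      otF∊κ s sm = let (l , sF) = F-bounded s sm in Small⇒ot∊ rκ (on l) sF

      G-⊑ : ∀ {y} → y ⊑ θ′ → Small κ y → G y ⊑ θ′
      G-⊑ s sm = ⊑-intro λ m → case ∪-elim m of λ
        { (inj₁ n) → proj₁ (F-bounded s sm) · n
        ; (inj₂ n) → κ⊑θ′ · ∊-congˡ (≐-sym (❴❵-elim n)) (otF∊κ s sm) }

      G-small : ∀ {y} → y ⊑ θ′ → Small κ y → Small κ (G y)
      G-small s sm = Small-∪ rκ (proj₂ (F-bounded s sm)) (Small-❴❵ rκ _)

      -- Ranging over `𝒫 θ′` keeps the condition in `Set`, as the separations defining `H` and `T₀`
      -- require.
      Closed : V → V → Set
      Closed s t = ∀[ y ∈ 𝒫 θ′ ] (y ⊑ t → ot y ∊ s → ot y ∊ κ → G y ⊑ t)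

      Closed-elim : ∀ {s t y} → Closed s t → y ⊑ θ′ → y ⊑ t → ot y ∊ s → ot y ∊ κ →
                    G y ⊑ t
      Closed-elim c s l p q =
        let (mem (k , e)) = 𝒫-intro s in
        ⊑-trans (≐⇒⊑ (G-cong e))
          (c k (⊑-trans (≐⇒⊑ (≐-sym e)) l) (∊-congˡ (ot-cong e) p) (∊-congˡ (ot-cong e) q))

      Closed-resp : ∀ {s s′ t t′} → s′ ⊑ s → t ≐ t′ → Closed s t → Closed s′ t′
      Closed-resp s′⊑s e c k l p q =
        ⊑-trans (c k (⊑-trans l (≐⇒⊑ (≐-sym e))) (s′⊑s · p) q) (≐⇒⊑ e)

      InHull : V → V → Set
      InHull s a = ∀[ t ∈ 𝒫 θ′ ] (s ⊑ t → Closed s t → a ∊ t)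

      InHull-resp : ∀ s → Respects (InHull s)
      InHull-resp s e h k l c = ∊-congˡ e (h k l c)

      -- An intersection of closed supersets rather than an iteration; smallness of hulls of traces
      -- is obtained in `T₀-hull`.
      H : V → V
      H s = separate θ′ (InHull s)

      H-⊑ : ∀ {s} → H s ⊑ θ′
      H-⊑ {s} = separate-⊑ θ′ (InHull s)

      H-intro : ∀ {s a} → a ∊ θ′ → InHull s a → a ∊ H s
      H-intro {s} = separate-intro (InHull s) (InHull-resp s)

      H-elim : ∀ {s a} → a ∊ H s → InHull s a
      H-elim {s} = separate-elim θ′ (InHull s) (InHull-resp s)

      H-base : ∀ {s} → s ⊑ θ′ → s ⊑ H s
      H-base l = ⊑-intro λ m → H-intro (l · m) λ _ s⊑t _ → s⊑t · m

      H-least : ∀ {s t} → t ⊑ θ′ → s ⊑ t → Closed s t → H s ⊑ t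
      H-least l s⊑t c = ⊑-intro λ m →
        let (mem (k , e)) = 𝒫-intro l in
        ∊-congʳ (≐-sym e) (H-elim m k (⊑-trans s⊑t (≐⇒⊑ e)) (Closed-resp ⊑-refl e c))

      H-closed : ∀ {s y} → y ⊑ H s → Small κ y → ot y ∊ s → ot y ∊ κ → G y ⊑ H s
      H-closed {s} l sm p q = ⊑-intro λ m →
        H-intro (G-⊑ (⊑-trans l (H-⊑ {s})) sm · m) λ k s⊑t c →
          Closed-elim c (⊑-trans l (H-⊑ {s}))
            (⊑-intro λ n → H-elim (l · n) k s⊑t c) p q · m

      -- Being closed relative to a larger set is more demanding, so every set that competes for
      -- `H s′` also competes for `H s`.
      H-mono : ∀ {s s′} → s ⊑ s′ → H s ⊑ H s′
      H-mono {s} l = ⊑-intro λ m → H-intro (H-⊑ {s} · m) λ k s′⊑t c →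
        H-elim m k (⊑-trans l s′⊑t) (Closed-resp l ≐-refl c)

      -- The size of `t` is expressed by `ot t ∊ κ` because `Small` lives in `Set₁` and could not be
      -- used in a separation.
      Trace : V → Set
      Trace s = ∃[ t ∈ 𝒫 θ′ ] ot t ∊ κ × Closed s t × s ≐ t ∩ θ

      Trace-resp : Respects Trace
      Trace-resp e (k , p , c , d) =
        k , p , Closed-resp (≐⇒⊑ (≐-sym e)) ≐-refl c , ≐-trans (≐-sym e) d

      T₀ : V
      T₀ = separate (𝒫[ κ ] θ) Trace

      -- `Closing` gives a small `t` containing `z` that is closed relative to itself, hence
      -- relative to its subset `t ∩ θ`.
      T₀-cofinal : Cofinal κ θ T₀
      T₀-cofinal .cover {z} z⊑θ z-small = conclude C.closure
        where
        module C = Closing.Chain mahlo oθ′ G G-cong G-⊑ G-small (⊑-trans z⊑θ θ⊑θ′) z-small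
        conclude : C.Closure → Σ[ s ∈ V ] s ∊ T₀ × z ⊑ s
        conclude (t , z⊑t , t⊑ , t-small , closed) =
          let (mem (k , e)) = 𝒫-intro t⊑
              t∩θ⊑t = ∩-⊑ˡ t θ
          in t ∩ θ ,
             separate-intro Trace Trace-resp
               (𝒫[]-intro rκ (λ m → Ord-∊ oθ (∩-⊑ʳ t θ · m)) (∩-⊑ʳ t θ)
                 (Small-⊑ rκ t∩θ⊑t t-small))
               ( k , ∊-congˡ (ot-cong e) (Small⇒ot∊ rκ (on t⊑) t-small)
               , Closed-resp ⊑-refl e (λ i l p q → closed l (t∩θ⊑t · p) q)
               , ∩-congˡ θ e ) ,
             ⊑-intro λ m → ∩-intro (z⊑t · m) (z⊑θ · m)

      T₀-⊑θ : ∀ {s} → s ∊ T₀ → s ⊑ θ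
      T₀-⊑θ m = proj₁ (𝒫[]-elim θ rκ (separate-⊑ (𝒫[ κ ] θ) Trace · m))

      -- If `s` is the trace of a closed `t`, then `H s ⊑ t` by leastness, so the hull is small and
      -- adds no element of `θ` to `s`.
      T₀-hull : ∀ {s} → s ∊ T₀ → Small κ (H s) × (∀ {a} → a ∊ H s → a ∊ θ → a ∊ s)
      T₀-hull {s} m =
        let (k , p , c , e) = separate-elim (𝒫[ κ ] θ) Trace Trace-resp m
            t  = el (𝒫 θ′) k
            t⊑ = 𝒫-elim θ′ (el∊ (𝒫 θ′) k)
            Hs⊑t = H-least t⊑ (⊑-trans (≐⇒⊑ e) (∩-⊑ˡ t θ)) c
        in Small-⊑ rκ Hs⊑t (ot∊⇒Small rκ (on t⊑) p) ,
           λ n q → ∊-congʳ (≐-sym e) (∩-intro (Hs⊑t · n) q)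

      -- From a reflection point `X` in `θ` to one in `θ′`.

      module Extend {X μ : V} (X⊑θ : X ⊑ θ) (X-small : Small κ X) (μ≐ : μ ≐ X ∩ κ)
                  (rμ : Reg μ) (cof : Cofinal μ X (T₀ ∩ 𝒫[ μ ] X)) where

        D : V
        D = T₀ ∩ 𝒫[ μ ] X

        D-T₀ : ∀ {s} → s ∊ D → s ∊ T₀
        D-T₀ m = ∩-⊑ˡ T₀ (𝒫[ μ ] X) · m

        D-bounded : ∀ {s} → s ∊ D → s ⊑ X × Small μ s
        D-bounded m = 𝒫[]-elim X rμ (∩-⊑ʳ T₀ (𝒫[ μ ] X) · m)

        μ⊑X : μ ⊑ X
        μ⊑X = ⊑-trans (≐⇒⊑ μ≐) (∩-⊑ˡ X κ)

        μ⊑κ : μ ⊑ κ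
        μ⊑κ = ⊑-trans (≐⇒⊑ μ≐) (∩-⊑ʳ X κ)

        InSome : V → Set
        InSome a = ∃[ s ∈ D ] a ∊ H s

        InSome-resp : Respects InSome
        InSome-resp e (k , m) = k , ∊-congˡ e m

        x : V
        x = separate θ′ InSome

        x⊑θ′ : x ⊑ θ′
        x⊑θ′ = separate-⊑ θ′ InSome

        H⊑x : ∀ {s} → s ∊ D → H s ⊑ x
        H⊑x {s} (mem (k , e)) = ⊑-intro λ m →
          separate-intro InSome InSome-resp (H-⊑ {s} · m) (k , H-mono (≐⇒⊑ e) · m)

        x-elim : ∀ {a} → a ∊ x → Σ[ s ∈ V ] s ∊ D × a ∊ H s
        x-elim m = let (k , n) = separate-elim θ′ InSome InSome-resp m in
          el D k , el∊ D k , n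

        -- Hulls of traces add nothing inside `θ`, so `x ∩ θ` stays within `X`; conversely, covering
        -- the singleton of `b ∊ X` puts `b` into some `s ∊ D`.
        x∩θ≐X : x ∩ θ ≐ X
        x∩θ≐X = ≐-ext
          (λ m → let (s , s∊ , n) = x-elim (∩-⊑ˡ x θ · m) in
             proj₁ (D-bounded s∊) · proj₂ (T₀-hull (D-T₀ s∊)) n (∩-⊑ʳ x θ · m))
          (λ {b} m →
             let ❴b❵⊑X = ⊑-intro λ n → ∊-congˡ (≐-sym (❴❵-elim n)) m
                 (s , s∊ , l) = cover cof ❴b❵⊑X (Small-❴❵ rμ b)
             in ∩-intro
                  (H⊑x s∊ · H-base (⊑-trans (T₀-⊑θ (D-T₀ s∊)) θ⊑θ′) · l · ∊❴❵ b)
                  (X⊑θ · m))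

        μ≐x∩κ : μ ≐ x ∩ κ
        μ≐x∩κ = ≐-trans μ≐ (≐-ext
          (λ m → ∩-intro (∩-⊑ˡ x θ · ∊-congʳ (≐-sym x∩θ≐X) (∩-⊑ˡ X κ · m)) (∩-⊑ʳ X κ · m))
          (λ m → ∩-intro
            (∊-congʳ x∩θ≐X (∩-intro (∩-⊑ˡ x κ · m) (κ⊑θ · ∩-⊑ʳ x κ · m))) (∩-⊑ʳ x κ · m)))

        -- No count of `D` is made: one `s ∊ T₀` above `X` contains every `r ∊ D`, so its small hull
        -- contains all of `x`.
        x-small : Small κ x
        x-small =
          let (s , s∊ , X⊑s) = cover T₀-cofinal X⊑θ X-small in
          Small-⊑ rκ
            (⊑-intro λ m → let (r , r∊ , n) = x-elim m in
              H-mono (⊑-trans (proj₁ (D-bounded r∊)) X⊑s) · n)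
            (proj₁ (T₀-hull s∊))

        Chooser : Set₁
        Chooser = Σ[ g ∈ (V → V) ] (∀ {a b} → a ≐ b → g a ≐ g b) ×
                    (∀ {a} → a ∊ x → g a ∊ D × a ∊ H (g a))

        -- Picking one `s ∊ D` for each `a`, compatibly with `_≐_`, allows the union over a small
        -- `y` to be formed and remain small for `μ`.
        chooser : Chooser
        chooser = choose ac x D (λ a s → a ∊ H s)
          (λ e d m → H-mono (≐⇒⊑ d) · ∊-congˡ e m) x-elim

        T-cofinal : Chooser → Cofinal μ x (T ∩ 𝒫[ μ ] x)
        T-cofinal (g , g-cong , g-spec) .cover {y} y⊑x y-small =
          conclude (cover cof W⊑X W-small)
          where
          y⊑θ′ : y ⊑ θ′
          y⊑θ′ = ⊑-trans y⊑x x⊑θ′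
          y-smallκ : Small κ y
          y-smallκ = Small-⊑ rκ y⊑x x-small
          ot∊μ : ot y ∊ μ
          ot∊μ = Small⇒ot∊ rμ (on y⊑θ′) y-small
          -- Any `s ∊ D` above `W` contains the chosen sets, which gives `y ⊑ H s`, and contains
          -- `ot y`, which is what `H-closed` asks for.
          W : V
          W = ⋃ y g ∪ ❴ ot y ❵
          W⊑X : W ⊑ X
          W⊑X = ⊑-intro λ m → case ∪-elim m of λ
            { (inj₁ n) → let (a , p , q) = ⋃-elim y g n in
                proj₁ (D-bounded (proj₁ (g-spec (y⊑x · p)))) · q
            ; (inj₂ n) → μ⊑X · ∊-congˡ (≐-sym (❴❵-elim n)) ot∊μ }
          W-small : Small μ W
          W-small = Small-∪ rμ
            (Small-⋃ rμ y g g-cong y-small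
              λ p → proj₂ (D-bounded (proj₁ (g-spec (y⊑x · p)))))
            (Small-❴❵ rμ (ot y))
          conclude : (Σ[ s ∈ V ] s ∊ D × W ⊑ s) →
                     Σ[ z ∈ V ] z ∊ T ∩ 𝒫[ μ ] x × y ⊑ z
          conclude (s , s∊ , W⊑s) =
            F y , ∩-intro (proj₁ (F∊T y⊑θ′ y-smallκ))
                    (𝒫[]-intro rμ onF Fy⊑x (ot∊⇒Small rμ onF otF∊μ)) ,
            proj₂ (F∊T y⊑θ′ y-smallκ)
            where
            y⊑Hs : y ⊑ H s
            y⊑Hs = ⊑-intro λ {a} m →
              H-mono (⊑-intro λ n →
                W⊑s · ∪-⊑ˡ (⋃ y g) ❴ ot y ❵ · ⋃-intro y g g-cong m n)
              · proj₂ (g-spec (y⊑x · m))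
            Gy⊑Hs : G y ⊑ H s
            Gy⊑Hs = H-closed y⊑Hs y-smallκ
              (W⊑s · ∪-⊑ʳ (⋃ y g) ❴ ot y ❵ · ∊❴❵ (ot y)) (μ⊑κ · ot∊μ)
            Fy⊑x : F y ⊑ x
            Fy⊑x = ⊑-trans (∪-⊑ˡ (F y) ❴ ot (F y) ❵) (⊑-trans Gy⊑Hs (H⊑x s∊))
            -- The adjoined order type lies in `H s` and in `κ ⊑ θ`, so it falls into `s` and then
            -- into `X ∩ κ`; this makes `F y` small for `μ` and not just for `κ`.
            otF∊s : ot (F y) ∊ s
            otF∊s = proj₂ (T₀-hull (D-T₀ s∊))
              (Gy⊑Hs · ∪-⊑ʳ (F y) ❴ ot (F y) ❵ · ∊❴❵ (ot (F y)))
              (κ⊑θ · otF∊κ y⊑θ′ y-smallκ)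
            otF∊μ : ot (F y) ∊ μ
            otF∊μ = ∊-congʳ (≐-sym μ≐)
              (∩-intro (proj₁ (D-bounded s∊) · otF∊s) (otF∊κ y⊑θ′ y-smallκ))
            onF : ∀ {a} → a ∊ F y → Ord a
            onF = on (⊑-trans Fy⊑x x⊑θ′)

        x∊𝒫 : x ∊ 𝒫[ κ ] θ′
        x∊𝒫 = 𝒫[]-intro rκ (on x⊑θ′) x⊑θ′ x-small

      Up-reflects : ∀ {S} → S ⊑ 𝒫[ κ ] θ → Reflects κ S T₀ →
                    Reflects κ (S ↑⟨ κ , θ ⟩ θ′) T
      Up-reflects {S} S⊑ (X , μ , X∊S , μ≐ , wi , cof) =
        x , μ , ↑-intro x∊𝒫 (∊-congˡ (≐-sym x∩θ≐X) X∊S) , μ≐x∩κ , wi , T-cofinal chooser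
        where
        X-bounded : X ⊑ θ × Small κ X
        X-bounded = 𝒫[]-elim θ rκ (S⊑ · X∊S)
        open Extend (proj₁ X-bounded) (proj₂ X-bounded) μ≐ (WI⇒Reg wi) cof

    up : ∀ {S} → S ⊑ 𝒫[ κ ] θ → OneStat κ θ S → OneStat κ θ′ (S ↑⟨ κ , θ ⟩ θ′)
    up {S} S⊑ os T T⊑ c = conclude
      (choose ac (𝒫[ κ ] θ′) T _⊑_
        (λ e d l → ⊑-trans (≐⇒⊑ (≐-sym e)) (⊑-trans l (≐⇒⊑ d)))
        (λ m → let (s , sm) = 𝒫[]-elim θ′ rκ m in cover c s sm))
      where
      conclude : (Σ[ F ∈ (V → V) ] (∀ {y z} → y ≐ z → F y ≐ F z) ×
                    (∀ {y} → y ∊ 𝒫[ κ ] θ′ → F y ∊ T × y ⊑ F y)) →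
                 Reflects κ (S ↑⟨ κ , θ ⟩ θ′) T
      conclude (F , F-cong , F-spec) =
        Up-reflects S⊑ (os T₀ (separate-⊑ (𝒫[ κ ] θ) Trace) T₀-cofinal)
        where open Up T⊑ F F-cong F-spec

theorem4p6 : ExcludedMiddle (suc 0ℓ) → Choice →
    (κ λ₀ λ₀′ : V) → Mahlo κ → Cardinal λ₀ → Cardinal λ₀′ →
    κ ≤ λ₀ → λ₀ ∈ λ₀′ →
    (S : V) → S ⊆ 𝒫[ κ ] λ₀ →
    OneStationary κ λ₀ S ⇔ OneStationary κ λ₀′ (S ↑⟨ κ , λ₀ ⟩ λ₀′)
theorem4p6 em ac κ λ₀ λ₀′ mahlo (oλ₀ , _) (oλ₀′ , _) κ≤λ₀ λ₀∈λ₀′ S S⊆ = mk⇔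
  (λ h → OneStat⇒OneStationary rκ (Ord-∊ o′) (↑-⊑ S)
           (up S⊑ (OneStationary⇒OneStat rκ (Ord-∊ o) S⊑ h)))
  (λ h → OneStat⇒OneStationary rκ (Ord-∊ o) S⊑
           (down (OneStationary⇒OneStat rκ (Ord-∊ o′) (↑-⊑ S) h)))
  where
  em₀ : ExcludedMiddle 0ℓ
  em₀ {P} = Dec.map′ lower lift (em {P = Lift (suc 0ℓ) P})
  o : Ord λ₀
  o = Ordinal⇒Ord λ₀ oλ₀
  o′ : Ord λ₀′
  o′ = Ordinal⇒Ord λ₀′ oλ₀′
  S⊑ : S ⊑ 𝒫[ κ ] λ₀
  S⊑ = ⊆⇒⊑ S (𝒫[ κ ] λ₀) S⊆
  open Classical em₀
  open Transfer ac mahlo o o′ (≤⇒⊑ o κ≤λ₀) (∊⇒⊑ o′ (mem λ₀∈λ₀′))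
  rκ : Reg κ
  rκ = Regular⇒Reg (proj₁ (proj₂ (proj₁ mahlo)))
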